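{- Consider the game ${\rm SCN}(8,6)$. Its P-positions (among all configurations that can arise, i.e. circular arrangements of at most $8$ piles with positive pile sizes) are exactly the following: (1) the terminal configuration $()$; (2) the seven-pile configurations $(a,a,a,a,a,a,a)$ with $a\ge 1$; (3) the eight-pile configurations $(1,M,a,M-a+1,\alpha,M-b+1,b,M)$ where $M,a,b$ are positive integers with $a\le M$, $b\le M$ and $\alpha=\min\{M,a+b-1\}$, except that the configurations $(1,2p-1,p,p,2p-1,p,p,2p-1)$ with an integer $p\ge 1$ are not P-positions.
   Context: Shrinking Circular Nim ${\rm SCN}(n,k)$, for positive integers $k\le n$: initially $n$ piles of stones are arranged on a circle. Two players alternate turns. On a turn, a player selects $k$ consecutive (cyclically adjacent) piles among the currently remaining piles and removes any number of stones from each of them, removing at least one stone in total (some of the selected piles may be left untouched). Whenever a pile becomes empty it vanishes and the circle closes up: the remaining piles keep their cyclic order and the neighbours of the vanished pile become adjacent. If at most $k$ piles remain, a move may remove stones from any of the remaining piles (all of them may be selected). The player who removes the last stone wins (a player with no move loses). A configuration is written as the tuple $(x_1,\dots,x_r)$ of the positive pile sizes in cyclic order; tuples that agree up to rotation or reflection denote the same configuration, and $()$ denotes the empty (terminal) configuration. A P-position is a configuration from which the player to move loses under optimal play by the opponent. -}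

module Defs where

open import Data.Nat using (ℕ; zero; suc; _+_; _*_; _∸_; _≤_; _<_; _⊔_; _⊓_)
open import Data.Nat.DivMod using (_%_)
open import Data.Nat.ListAction using (sum)
open import Data.Empty using (⊥)
open import Data.List using (List; []; _∷_; length; drop; take; _++_; reverse)
open import Data.List.Relation.Binary.Pointwise using (Pointwise)
open import Data.Product using (Σ; ∃; _×_; _,_)
open import Data.Sum using (_⊎_)
open import Relation.Binary.PropositionalEquality using (_≡_; _≢_)

-- A configuration is the list of pile sizes in cyclic order.
Config : Set
Config = List ℕ

at : List ℕ → ℕ → ℕ
at []       _       = 0
at (x ∷ xs) zero    = x
at (x ∷ xs) (suc i) = at xs i

-- delete the empty piles (the circle closes up, cyclic order preserved)
removeZeros : List ℕ → List ℕ
removeZeros []            = []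
removeZeros (zero ∷ xs)   = removeZeros xs
removeZeros (suc x ∷ xs)  = suc x ∷ removeZeros xs

-- index i (< r) lies in the cyclic window of k consecutive positions
-- starting at position s (< r) of a circle with r positions
InWindow : ℕ → ℕ → ℕ → ℕ → Set
InWindow k r s i = ((i + r) ∸ s) % suc (r ∸ 1) < k

-- One move of Shrinking Circular Nim with parameter k, from xs to ys.
-- zs are the pile sizes right after removing stones (before deleting
-- empty piles); only piles inside a window of k cyclically consecutive
-- piles may change, unless at most k piles remain.
record Move (k : ℕ) (xs ys : Config) : Set where
  field
    zs        : List ℕ
    smaller   : Pointwise _≤_ zs xs
    removes   : sum zs < sum xs
    window    : length xs ≤ k
                ⊎ Σ ℕ (λ s → s < length xs ×
                    ((i : ℕ) → i < length xs → at zs i ≢ at xs i →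
                       InWindow k (length xs) s i))
    result    : ys ≡ removeZeros zs

mutual
  data IsP (k : ℕ) (xs : Config) : Set where
    isP : ((ys : Config) → Move k xs ys → IsN k ys) → IsP k xs

  data IsN (k : ℕ) (xs : Config) : Set where
    isN : (ys : Config) → Move k xs ys → IsP k ys → IsN k xs

rotate : ℕ → List ℕ → List ℕ
rotate i xs = drop i xs ++ take i xs

_≈c_ : Config → Config → Set
xs ≈c ys = ∃ λ i → (ys ≡ rotate i xs) ⊎ (ys ≡ rotate i (reverse xs))

family8 : ℕ → ℕ → ℕ → Config
family8 M a b =
  1 ∷ M ∷ a ∷ (M ∸ a + 1) ∷ (M ⊓ (a + b ∸ 1)) ∷ (M ∸ b + 1) ∷ b ∷ M ∷ []

exception8 : ℕ → Config
exception8 p =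
  1 ∷ (2 * p ∸ 1) ∷ p ∷ p ∷ (2 * p ∸ 1) ∷ p ∷ p ∷ (2 * p ∸ 1) ∷ []

ClaimedP : Config → Set
ClaimedP c =
    c ≡ []
  ⊎ (∃ λ a → 1 ≤ a × c ≡ a ∷ a ∷ a ∷ a ∷ a ∷ a ∷ a ∷ [])
  ⊎ ((∃ λ M → ∃ λ a → ∃ λ b →
        1 ≤ a × a ≤ M × 1 ≤ b × b ≤ M × c ≈c family8 M a b)
     × ((p : ℕ) → 1 ≤ p → c ≈c exception8 p → ⊥))

{-# OPTIONS --safe #-}
module Submission where

-- Call the configurations (3), exceptions included, tubs.  A move leaves two adjacent piles of an eight-pile
-- configuration untouched.  If a tub lies below another one and agrees with it on two adjacent piles, the two
-- coincide; and a tub leaves two equal adjacent piles with at most one smaller pile only in the exceptional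
-- case.  Hence no move joins two claimed P-positions.
--
-- Conversely, subtract 1 from all piles of an eight-pile configuration and look for a tub (0,m,…,m) below it
-- at each position and in each orientation.  If the largest m that fits is not forced by the two neighbours
-- of the 0, or if one of these neighbours allows to keep it together with a pile next to it, a tub is
-- reached; when that tub is exceptional, a modification of it or seven equal piles are reached instead.
-- Otherwise the neighbours satisfy a system of linear inequalities, and the sixteen systems together are
-- contradictory.

open import Defs
open import Data.Bool using (Bool; true; false; _∧_; _∨_; if_then_else_; T)
open import Data.Bool.Properties using (T-∧)
open import Data.Empty using (⊥; ⊥-elim)
open import Data.Integer as ℤ using (ℤ; +_; -[1+_]; ∣_∣)
open import Data.List using (List; []; _∷_; _++_; length; map; reverse; replicate; drop; take; upTo; zipWith)
open import Data.List.Properties using (∷-injectiveˡ; ∷-injectiveʳ; length-++; length-replicate; length-reverse; take++drop≡id; take-[]; drop-[])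
open import Data.List.Relation.Binary.Pointwise using (Pointwise; []; _∷_; Pointwise-length)
open import Data.List.Relation.Unary.All as All using (All; []; _∷_)
import Data.List.Relation.Unary.All.Properties as All′
open import Data.Maybe using (Maybe; just; nothing)
open import Data.Nat
open import Data.Nat.DivMod using (_%_; m%n<n)
open import Data.Nat.Induction using (<-wellFounded; Acc; acc)
open import Data.Nat.ListAction using (sum)
open import Data.Nat.Properties
open import Data.Nat.Tactic.RingSolver using (solve-∀)
open import Data.Product using (∃; ∃₂; _×_; _,_; proj₁; proj₂)
open import Data.Sum as Sum using (_⊎_; inj₁; inj₂; [_,_]′)
open import Data.Unit using (tt)
open import Data.Vec as Vec using (Vec; []; _∷_; toList; zip)
open import Function using (_∘_; Equivalence)
open import Relation.Binary using (tri<; tri≈; tri>)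
open import Relation.Binary.PropositionalEquality
open import Relation.Nullary using (Dec; yes; no; ¬_; ¬?; _×-dec_; _⊎-dec_; _→-dec_; contradiction; decidable-stable)
open import Relation.Nullary.Decidable using (toWitness)

-- Linear arithmetic over the natural numbers

-- The constant term comes first; a linear form is evaluated at (1 ∷ ρ).
Linear : Set
Linear = List ℕ

infixl 7 _∙_
infixl 6 _⊞_
infix  7 _≤ᶜ_
infix  4 _≼_

_∙_ : Linear → List ℕ → ℕ
[]       ∙ _        = 0
(_ ∷ _)  ∙ []       = 0
(c ∷ cs) ∙ (x ∷ xs) = c * x + cs ∙ xs

_⊞_ : Linear → Linear → Linear
[]       ⊞ v        = v
u        ⊞ []       = u
(a ∷ u)  ⊞ (b ∷ v)  = a + b ∷ u ⊞ v

scale : ℕ → Linear → Linear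
scale k = map (k *_)

_≤ᶜ_ : Linear → Linear → Bool
[]      ≤ᶜ _       = true
(a ∷ u) ≤ᶜ []      = (a ≤ᵇ 0) ∧ u ≤ᶜ []
(a ∷ u) ≤ᶜ (b ∷ v) = (a ≤ᵇ b) ∧ u ≤ᶜ v

⊞-∙ : ∀ u v xs → (u ⊞ v) ∙ xs ≡ u ∙ xs + v ∙ xs
⊞-∙ []      v       xs       = refl
⊞-∙ (a ∷ u) []      xs       = sym (+-identityʳ _)
⊞-∙ (a ∷ u) (b ∷ v) []       = refl
⊞-∙ (a ∷ u) (b ∷ v) (x ∷ xs) = begin
  (a + b) * x + (u ⊞ v) ∙ xs            ≡⟨ cong (_+_ ((a + b) * x)) (⊞-∙ u v xs) ⟩
  (a + b) * x + (u ∙ xs + v ∙ xs)       ≡⟨ rearrange a b x (u ∙ xs) (v ∙ xs) ⟩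
  a * x + u ∙ xs + (b * x + v ∙ xs)     ∎
  where
  open ≡-Reasoning
  rearrange : ∀ a b x p q → (a + b) * x + (p + q) ≡ a * x + p + (b * x + q)
  rearrange = solve-∀

scale-∙ : ∀ k u xs → scale k u ∙ xs ≡ k * (u ∙ xs)
scale-∙ k []      xs       = sym (*-zeroʳ k)
scale-∙ k (a ∷ u) []       = sym (*-zeroʳ k)
scale-∙ k (a ∷ u) (x ∷ xs) = trans (cong₂ _+_ (*-assoc k a x) (scale-∙ k u xs))
                                   (sym (*-distribˡ-+ k (a * x) (u ∙ xs)))

≤ᶜ-∙ : ∀ u v xs → T (u ≤ᶜ v) → u ∙ xs ≤ v ∙ xs
≤ᶜ-∙ []      v       xs       _ = z≤n
≤ᶜ-∙ (a ∷ u) v       []       _ = z≤n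
≤ᶜ-∙ (a ∷ u) []      (x ∷ xs) p with Equivalence.to T-∧ p
... | a≤0 , u≤0 rewrite n≤0⇒n≡0 (≤ᵇ⇒≤ a 0 a≤0) = ≤ᶜ-∙ u [] xs u≤0
≤ᶜ-∙ (a ∷ u) (b ∷ v) (x ∷ xs) p with Equivalence.to T-∧ p
... | a≤b , u≤v = +-mono-≤ (*-monoˡ-≤ x (≤ᵇ⇒≤ a b a≤b)) (≤ᶜ-∙ u v xs u≤v)

record Ineq : Set where
  constructor _≼_
  field lhs rhs : Linear

Holds : List ℕ → Ineq → Set
Holds ρ (u ≼ v) = u ∙ (1 ∷ ρ) ≤ v ∙ (1 ∷ ρ)

combine : List ℕ → List Ineq → Ineq
combine []       _              = [] ≼ []
combine (_ ∷ _)  []             = [] ≼ []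
combine (k ∷ ks) ((u ≼ v) ∷ is) = let u′ ≼ v′ = combine ks is in (scale k u ⊞ u′) ≼ (scale k v ⊞ v′)

-- The multipliers are arbitrary, so whatever the simplex search returns is checked here and the
-- search itself requires no correctness proof.
combine-holds : ∀ ρ ks is → All (Holds ρ) is → Holds ρ (combine ks is)
combine-holds ρ []       is             hs       = z≤n
combine-holds ρ (k ∷ ks) []             hs       = z≤n
combine-holds ρ (k ∷ ks) ((u ≼ v) ∷ is) (h ∷ hs)
  rewrite ⊞-∙ (scale k u) (Ineq.lhs (combine ks is)) (1 ∷ ρ)
        | ⊞-∙ (scale k v) (Ineq.rhs (combine ks is)) (1 ∷ ρ)
        | scale-∙ k u (1 ∷ ρ) | scale-∙ k v (1 ∷ ρ)
  = +-mono-≤ (*-monoʳ-≤ k h) (combine-holds ρ ks is hs)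

-- The variables are natural numbers, so a left side that is coefficientwise at least the right
-- side, with a strictly larger constant, already refutes the inequality.
absurd : Ineq → Bool
absurd ([]      ≼ v)       = false
absurd ((a ∷ u) ≼ [])      = 0 <ᵇ a
absurd ((a ∷ u) ≼ (b ∷ v)) = (b <ᵇ a) ∧ v ≤ᶜ u

absurd-sound : ∀ ρ i → T (absurd i) → ¬ Holds ρ i
absurd-sound ρ ((a ∷ u) ≼ [])      p h =
  <⇒≱ (<ᵇ⇒< 0 a p) (≤-trans (≤-reflexive (sym (*-identityʳ a))) (≤-trans (m≤m+n _ _) h))
absurd-sound ρ ((a ∷ u) ≼ (b ∷ v)) p h with Equivalence.to T-∧ p
... | b<a , v≤u = <⇒≱ (+-mono-<-≤ (*-monoˡ-< 1 (<ᵇ⇒< b a b<a)) (≤ᶜ-∙ v u ρ v≤u)) h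

-- Search for Farkas multipliers

module Simplex where

  Vector : Set
  Vector = List ℤ

  entry : Vector → ℕ → ℤ
  entry []       _       = + 0
  entry (x ∷ xs) zero    = x
  entry (x ∷ xs) (suc i) = entry xs i

  dot : Vector → Vector → ℤ
  dot (x ∷ xs) (y ∷ ys) = x ℤ.* y ℤ.+ dot xs ys
  dot _        _        = + 0

  divide : ℕ → ℤ → ℤ
  divide d (+ n)    = + (n / suc d)
  divide d -[1+ n ] = ℤ.- (+ (suc n / suc d))

  positive negative : ℤ → Bool
  positive (+ suc _) = true
  positive _         = false
  negative -[1+ _ ]  = true
  negative _         = false

  -- The revised simplex method with Bland's rule for the dual problem, that of finding Farkas
  -- multipliers.  Labels below the number of variables stand for the slack columns, so that point and
  -- rows restricted to them are the reduced costs and the inverse basis matrix, both scaled by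
  -- suc denominator; the point is also the candidate solution of the constraints.
  record Tableau : Set where
    constructor tableau
    field
      denominator : ℕ
      point       : Vector
      rows        : List (ℕ × Vector)
      constraints : List (ℕ × Vector)

  initial : ℕ → Tableau
  initial n = tableau 0 (map (λ _ → + 0) (upTo n)) (map (λ j → j , map (λ i → if i ≡ᵇ j then + 1 else + 0) (upTo n)) (upTo n)) []

  data Step : Set where
    feasible : Step
    entering : ℕ → ℤ → Vector → Step

  enterConstraint : ℕ → Vector → List (ℕ × Vector) → List (ℕ × Vector) → Step
  enterConstraint d y rs []                   = feasible
  enterConstraint d y rs ((l , []) ∷ cs)      = enterConstraint d y rs cs
  enterConstraint d y rs ((l , c₀ ∷ c) ∷ cs) = let f = c₀ ℤ.* (+ suc d) ℤ.+ dot c y in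
    if negative f then entering l f (map (dot c ∘ proj₂) rs) else enterConstraint d y rs cs

  enterSlack : ℕ → Vector → List (ℕ × Vector) → Step → Step
  enterSlack j []      rs k = k
  enterSlack j (f ∷ y) rs k = if negative f then entering j f (map (λ r → entry (proj₂ r) j) rs) else enterSlack (suc j) y rs k

  -- The constraints on the multipliers are homogeneous, so every basic value is zero and all
  -- positive entries tie in the ratio test; the smallest label is taken. Without a positive entry
  -- the column spans an unbounded ray.
  leaving : Vector → List (ℕ × Vector) → Maybe (ℤ × ℕ × Vector)
  leaving (u ∷ us) ((b , r) ∷ rs) with positive u | leaving us rs
  ... | false | best                = best
  ... | true  | nothing             = just (u , b , r)
  ... | true  | just (u′ , b′ , r′) = just (if b <ᵇ b′ then (u , b , r) else (u′ , b′ , r′))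
  leaving _ _ = nothing

  -- Fraction-free pivoting: the entries are minors over a common denominator, so division by the
  -- previous denominator is exact.
  eliminate : ℕ → ℤ → Vector → ℤ → Vector → Vector
  eliminate d p pr f = zipWith (λ z x → divide d (p ℤ.* x ℤ.- f ℤ.* z)) pr

  pivot : ℕ → ℕ → ℤ → ℕ → Vector → Vector → List (ℕ × Vector) → List (ℕ × Vector)
  pivot d e p l pr (u ∷ us) ((b , r) ∷ rs) =
    (if b ≡ᵇ l then (e , r) else (b , eliminate d p pr u r)) ∷ pivot d e p l pr us rs
  pivot d e p l pr _        _              = []

  -- The coordinates of the unbounded ray. Its column has no positive entry, so the absolute values
  -- are the multipliers of the basic constraints, and the entering one gets the denominator.
  multiplier : ℕ → ℕ → Vector → List (ℕ × Vector) → ℕ → ℕ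
  multiplier d e (u ∷ us) ((b , _) ∷ rs) i = if i ≡ᵇ b then ∣ u ∣ else multiplier d e us rs i
  multiplier d e _        _              i = if i ≡ᵇ e then suc d else 0

  optimise : ℕ → Tableau → List ℕ ⊎ Tableau
  optimise zero       t = inj₂ t
  optimise (suc fuel) t@(tableau d y rs cs) with enterSlack 0 y rs (enterConstraint d y rs cs)
  ... | feasible        = inj₂ t
  ... | entering e f us with leaving us rs
  ...   | nothing            = inj₁ (map (multiplier d e us rs ∘ proj₁) cs)
  ...   | just (p , l , pr)  = optimise fuel (tableau (pred ∣ p ∣) (eliminate d p pr f y) (pivot d e p l pr us rs) cs)

  differences : Linear → Linear → Vector
  differences []      v       = map +_ v
  differences (a ∷ u) []      = ℤ.- (+ a) ∷ differences u []
  differences (a ∷ u) (b ∷ v) = b ℤ.⊖ a ∷ differences u v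

  constrain : Ineq → Tableau → Tableau
  constrain (u ≼ v) (tableau d y rs cs) = tableau d y rs ((length rs + length cs , differences u v) ∷ cs)

  -- Homogeneous coordinates: the denominator stands in the place of the constant 1, so inequalities
  -- can be tested without fractions.
  solution : Tableau → List ℕ
  solution (tableau d y _ _) = suc d ∷ map ∣_∣ y

-- Refutation by case splitting

data Goal : Set where
  lit       : Ineq → Goal
  false     : Goal
  _and_ _or_ : Goal → Goal → Goal

True : List ℕ → Goal → Set
True ρ (lit i)   = Holds ρ i
True ρ false     = ⊥
True ρ (g and h) = True ρ g × True ρ h
True ρ (g or h)  = True ρ g ⊎ True ρ h

satisfied : List ℕ → Goal → Bool
satisfied p (lit (u ≼ v)) = u ∙ p ≤ᵇ v ∙ p
satisfied p false         = false
satisfied p (g and h)     = satisfied p g ∧ satisfied p h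
satisfied p (g or h)      = satisfied p g ∨ satisfied p h

-- Splitting only on constraints violated at the current solution keeps the linear programs small.
extract : List ℕ → List Goal → Maybe (Goal × List Goal)
extract p []       = nothing
extract p (g ∷ gs) with satisfied p g | extract p gs
... | true  | nothing         = nothing
... | true  | just (g′ , gs′) = just (g′ , g ∷ gs′)
... | false | _               = just (g , gs)

branch : (List Ineq → List Goal → Bool) → List ℕ → List Ineq → Goal → List Goal → Bool
branch k p is (lit i)   gs = k (i ∷ is) gs
branch k p is false     gs = true
branch k p is (g and h) gs = if satisfied p g then branch k p is h (g ∷ gs) else branch k p is g (h ∷ gs)
branch k p is (g or h)  gs = branch k p is g gs ∧ branch k p is h gs

mutual
  -- The answer `false` carries no information: it covers satisfiable systems, those without a
  -- rational refutation, and exhausted fuel. The constraints of the tableau are always those of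
  -- `is`, in the same order, so the multipliers match.
  refutable : ℕ → Simplex.Tableau → List Ineq → List Goal → Bool
  refutable zero       t is gs = false
  refutable (suc fuel) t is gs with Simplex.optimise 200 t
  ... | inj₁ ks = absurd (combine ks is)
  ... | inj₂ t′ with extract (Simplex.solution t′) gs
  ...   | nothing        = false
  ...   | just (g , gs′) = branch (assuming fuel t′) (Simplex.solution t′) is g gs′

  assuming : ℕ → Simplex.Tableau → List Ineq → List Goal → Bool
  assuming fuel t []       gs = false
  assuming fuel t (i ∷ is) gs = refutable fuel (Simplex.constrain i t) (i ∷ is) gs

extract-All : ∀ {P : Goal → Set} p gs {g gs′} → extract p gs ≡ just (g , gs′) → All P gs → P g × All P gs′
extract-All p (g ∷ gs) eq (h ∷ hs) with satisfied p g | extract p gs in eq′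
extract-All p (g ∷ gs) refl (h ∷ hs) | true  | just _ = let q , qs = extract-All p gs eq′ hs in q , h ∷ qs
extract-All p (g ∷ gs) refl (h ∷ hs) | false | _      = h , hs

Refutes : List ℕ → (List Ineq → List Goal → Bool) → Set
Refutes ρ k = ∀ is gs → T (k is gs) → All (Holds ρ) is → All (True ρ) gs → ⊥

branch-sound : ∀ {ρ k} → Refutes ρ k → ∀ p is g gs → T (branch k p is g gs) →
  All (Holds ρ) is → True ρ g → All (True ρ) gs → ⊥
branch-sound r p is (lit i)   gs t his hi hgs = r (i ∷ is) gs t (hi ∷ his) hgs
branch-sound r p is (g and h) gs t his (hg , hh) hgs with satisfied p g
... | true  = branch-sound r p is h (g ∷ gs) t his hh (hg ∷ hgs)
... | false = branch-sound r p is g (h ∷ gs) t his hg (hh ∷ hgs)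
branch-sound r p is (g or h)  gs t his (inj₁ hg) hgs =
  branch-sound r p is g gs (proj₁ (Equivalence.to T-∧ t)) his hg hgs
branch-sound {k = k} r p is (g or h)  gs t his (inj₂ hh) hgs =
  branch-sound r p is h gs (proj₂ (Equivalence.to (T-∧ {branch k p is g gs}) t)) his hh hgs

mutual
  refutable-sound : ∀ fuel t ρ → Refutes ρ (refutable fuel t)
  refutable-sound (suc fuel) t ρ is gs v his hgs with Simplex.optimise 200 t
  ... | inj₁ ks = absurd-sound ρ (combine ks is) v (combine-holds ρ ks is his)
  ... | inj₂ t′ with extract (Simplex.solution t′) gs in eq
  ...   | just (g , gs′) = let hg , hgs′ = extract-All _ gs eq hgs in
    branch-sound (assuming-sound fuel t′ ρ) _ is g gs′ v his hg hgs′

  assuming-sound : ∀ fuel t ρ → Refutes ρ (assuming fuel t)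
  assuming-sound fuel t ρ (i ∷ is) gs v his hgs = refutable-sound fuel _ ρ (i ∷ is) gs v his hgs

-- Formulas of linear arithmetic and their decision

infixl 7 _:+_
infix  5 _:≤_ _:<_ _:≡_
infixr 4 _:∧_
infixr 3 _:∨_
infixr 2 _:⇒_

data Term : Set where
  con  : ℕ → Term
  var  : ℕ → Term
  _:+_ : Term → Term → Term

data Formula : Set where
  _:≤_ _:≡_      : Term → Term → Formula
  :⊥             : Formula
  _:∧_ _:∨_ _:⇒_ : Formula → Formula → Formula

_:<_ : Term → Term → Formula
t :< u = con 1 :+ t :≤ u

⟦_⟧ᵗ : Term → List ℕ → ℕ
⟦ con n ⟧ᵗ  ρ = n
⟦ var i ⟧ᵗ  ρ = at ρ i
⟦ t :+ u ⟧ᵗ ρ = ⟦ t ⟧ᵗ ρ + ⟦ u ⟧ᵗ ρ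

⟦_⟧ : Formula → List ℕ → Set
⟦ t :≤ u ⟧ ρ = ⟦ t ⟧ᵗ ρ ≤ ⟦ u ⟧ᵗ ρ
⟦ t :≡ u ⟧ ρ = ⟦ t ⟧ᵗ ρ ≡ ⟦ u ⟧ᵗ ρ
⟦ :⊥ ⟧     ρ = ⊥
⟦ p :∧ q ⟧ ρ = ⟦ p ⟧ ρ × ⟦ q ⟧ ρ
⟦ p :∨ q ⟧ ρ = ⟦ p ⟧ ρ ⊎ ⟦ q ⟧ ρ
⟦ p :⇒ q ⟧ ρ = ⟦ p ⟧ ρ → ⟦ q ⟧ ρ

decide : ∀ p ρ → Dec (⟦ p ⟧ ρ)
decide (t :≤ u) ρ = _ ≤? _
decide (t :≡ u) ρ = _ ≟ _
decide :⊥       ρ = no λ ()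
decide (p :∧ q) ρ = decide p ρ ×-dec decide q ρ
decide (p :∨ q) ρ = decide p ρ ⊎-dec decide q ρ
decide (p :⇒ q) ρ = decide p ρ →-dec decide q ρ

basis : ℕ → Linear
basis zero    = 1 ∷ []
basis (suc i) = 0 ∷ basis i

linear : Term → Linear
linear (con n)  = n ∷ []
linear (var i)  = 0 ∷ basis i
linear (t :+ u) = linear t ⊞ linear u

basis-∙ : ∀ i ρ → basis i ∙ ρ ≡ at ρ i
basis-∙ zero    []      = refl
basis-∙ (suc i) []      = refl
basis-∙ zero    (x ∷ ρ) = trans (+-identityʳ _) (+-identityʳ x)
basis-∙ (suc i) (x ∷ ρ) = basis-∙ i ρ

linear-∙ : ∀ t ρ → linear t ∙ (1 ∷ ρ) ≡ ⟦ t ⟧ᵗ ρ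
linear-∙ (con n)  ρ = trans (+-identityʳ _) (*-identityʳ n)
linear-∙ (var i)  ρ = basis-∙ i ρ
linear-∙ (t :+ u) ρ = trans (⊞-∙ (linear t) (linear u) (1 ∷ ρ)) (cong₂ _+_ (linear-∙ t ρ) (linear-∙ u ρ))

ineq : Term → Term → Ineq
ineq t u = linear t ≼ linear u

ineq-holds : ∀ {ρ} t u → ⟦ t ⟧ᵗ ρ ≤ ⟦ u ⟧ᵗ ρ → Holds ρ (ineq t u)
ineq-holds {ρ} t u = subst₂ _≤_ (sym (linear-∙ t ρ)) (sym (linear-∙ u ρ))

mutual
  nnf : Formula → Goal
  nnf (t :≤ u) = lit (ineq t u)
  nnf (t :≡ u) = lit (ineq t u) and lit (ineq u t)
  nnf :⊥       = false
  nnf (p :∧ q) = nnf p and nnf q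
  nnf (p :∨ q) = nnf p or nnf q
  nnf (p :⇒ q) = nnf¬ p or nnf q

  -- Integrality enters here only: the negation of an inequality is sharpened by 1, and the rest of
  -- the argument is rational.
  nnf¬ : Formula → Goal
  nnf¬ (t :≤ u) = lit (ineq (con 1 :+ u) t)
  nnf¬ (t :≡ u) = lit (ineq (con 1 :+ t) u) or lit (ineq (con 1 :+ u) t)
  nnf¬ :⊥       = lit ([] ≼ [])
  nnf¬ (p :∧ q) = nnf¬ p or nnf¬ q
  nnf¬ (p :∨ q) = nnf¬ p and nnf¬ q
  nnf¬ (p :⇒ q) = nnf p and nnf¬ q

mutual
  nnf-true : ∀ p {ρ} → ⟦ p ⟧ ρ → True ρ (nnf p)
  nnf-true (t :≤ u) h        = ineq-holds t u h
  nnf-true (t :≡ u) h        = ineq-holds t u (≤-reflexive h) , ineq-holds u t (≤-reflexive (sym h))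
  nnf-true (p :∧ q) (g , h)  = nnf-true p g , nnf-true q h
  nnf-true (p :∨ q) (inj₁ h) = inj₁ (nnf-true p h)
  nnf-true (p :∨ q) (inj₂ h) = inj₂ (nnf-true q h)
  nnf-true (p :⇒ q) {ρ} h with decide p ρ
  ... | yes g = inj₂ (nnf-true q (h g))
  ... | no ¬g = inj₁ (nnf¬-true p ¬g)

  nnf¬-true : ∀ p {ρ} → ¬ ⟦ p ⟧ ρ → True ρ (nnf¬ p)
  nnf¬-true (t :≤ u) h = ineq-holds (con 1 :+ u) t (≰⇒> h)
  nnf¬-true (t :≡ u) {ρ} h with <-cmp (⟦ t ⟧ᵗ ρ) (⟦ u ⟧ᵗ ρ)
  ... | tri< lt _ _ = inj₁ (ineq-holds (con 1 :+ t) u lt)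
  ... | tri≈ _ eq _ = ⊥-elim (h eq)
  ... | tri> _ _ gt = inj₂ (ineq-holds (con 1 :+ u) t gt)
  nnf¬-true :⊥       h = z≤n
  nnf¬-true (p :∧ q) {ρ} h with decide p ρ
  ... | yes g = inj₂ (nnf¬-true q (h ∘ (g ,_)))
  ... | no ¬g = inj₁ (nnf¬-true p ¬g)
  nnf¬-true (p :∨ q) h = nnf¬-true p (h ∘ inj₁) , nnf¬-true q (h ∘ inj₂)
  nnf¬-true (p :⇒ q) {ρ} h = nnf-true p (decidable-stable (decide p ρ) λ ¬p → h (⊥-elim ∘ ¬p))
                           , nnf¬-true q (λ g → h λ _ → g)

conjuncts : Goal → List Goal
conjuncts (g and h) = conjuncts g ++ conjuncts h
conjuncts g         = g ∷ []

conjuncts-true : ∀ {ρ} g → True ρ g → All (True ρ) (conjuncts g)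
conjuncts-true (lit i)   h        = h ∷ []
conjuncts-true false     h        = h ∷ []
conjuncts-true (g and h) (p , q)  = All′.++⁺ (conjuncts-true g p) (conjuncts-true h q)
conjuncts-true (g or h)  p        = p ∷ []

valid : ℕ → Formula → Bool
valid n p = refutable 100 (Simplex.initial n) [] (conjuncts (nnf¬ p))

valid-sound : ∀ n p ρ → T (valid n p) → ⟦ p ⟧ ρ
valid-sound n p ρ v = decidable-stable (decide p ρ) λ ¬p →
  refutable-sound 100 (Simplex.initial n) ρ [] _ v [] (conjuncts-true (nnf¬ p) (nnf¬-true p ¬p))

-- A lemma proved by solve states the formula passed to it, so its type is left to be inferred.
Abstracted : ℕ → Set → Set
Abstracted zero    A = A
Abstracted (suc n) A = Term → Abstracted n A

close : ∀ {A} n → ℕ → Abstracted n A → A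
close zero    i f = f
close (suc n) i f = close n (suc i) (f (var i))

Universal : ℕ → (List ℕ → Set) → Set
Universal zero    P = P []
Universal (suc n) P = ∀ x → Universal n (P ∘ (x ∷_))

universal : ∀ n {P : List ℕ → Set} → (∀ ρ → P ρ) → Universal n P
universal zero    h   = h []
universal (suc n) h x = universal n (h ∘ (x ∷_))

solve : ∀ n (f : Abstracted n Formula) → valid n (close n 0 f) ≡ true → Universal n ⟦ close n 0 f ⟧
solve n f v = universal n λ ρ → valid-sound n (close n 0 f) ρ (subst T (sym v) tt)

-- Configurations of eight piles

Predicate : Set
Predicate = (x₀ x₁ x₂ x₃ x₄ x₅ x₆ x₇ : Term) → Formula

private variable
  A   : Set
  P Q : Vec A 8 → Set

Octet : Set
Octet = Vec ℕ 8

holds : Predicate → Octet → Set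
holds P xs = ⟦ P (var 0) (var 1) (var 2) (var 3) (var 4) (var 5) (var 6) (var 7) ⟧ (toList xs)

holds? : ∀ P xs → Dec (holds P xs)
holds? P xs = decide _ (toList xs)

turn flip : Vec A 8 → Vec A 8
turn (x₀ ∷ x₁ ∷ x₂ ∷ x₃ ∷ x₄ ∷ x₅ ∷ x₆ ∷ x₇ ∷ []) = x₁ ∷ x₂ ∷ x₃ ∷ x₄ ∷ x₅ ∷ x₆ ∷ x₇ ∷ x₀ ∷ []
flip (x₀ ∷ x₁ ∷ x₂ ∷ x₃ ∷ x₄ ∷ x₅ ∷ x₆ ∷ x₇ ∷ []) = x₀ ∷ x₇ ∷ x₆ ∷ x₅ ∷ x₄ ∷ x₃ ∷ x₂ ∷ x₁ ∷ []

-- Only rotations are recorded; reflections are covered because the predicates describing tubs are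
-- closed under `flip`.
data Orbit (P : Vec A 8 → Set) (xs : Vec A 8) : Set where
  here  : P xs → Orbit P xs
  there : Orbit P (turn xs) → Orbit P xs

Orbit-map : (∀ xs → P xs → Q xs) → ∀ {xs} → Orbit P xs → Orbit Q xs
Orbit-map f (here p)  = here (f _ p)
Orbit-map f (there o) = there (Orbit-map f o)

Orbit-elim : (∀ xs → Q (turn xs) → Q xs) → (∀ xs → P xs → Q xs) → ∀ {xs} → Orbit P xs → Q xs
Orbit-elim t f (here p)  = f _ p
Orbit-elim t f (there o) = t _ (Orbit-elim t f o)

Orbit-turn : ∀ {xs} → Orbit P xs → Orbit P (turn xs)
Orbit-turn {xs = _ ∷ _ ∷ _ ∷ _ ∷ _ ∷ _ ∷ _ ∷ _ ∷ []} (here p) =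
  there (there (there (there (there (there (there (here p)))))))
Orbit-turn (there o) = o

Orbit-flip : (∀ xs → P xs → Orbit Q (flip xs)) → ∀ {xs} → Orbit P xs → Orbit Q (flip xs)
Orbit-flip f (here p) = f _ p
Orbit-flip f {_ ∷ _ ∷ _ ∷ _ ∷ _ ∷ _ ∷ _ ∷ _ ∷ []} (there o) = Orbit-turn (Orbit-flip f o)

around : Predicate → Predicate
around P x₀ x₁ x₂ x₃ x₄ x₅ x₆ x₇ =
     P x₀ x₁ x₂ x₃ x₄ x₅ x₆ x₇
  :∨ P x₁ x₂ x₃ x₄ x₅ x₆ x₇ x₀
  :∨ P x₂ x₃ x₄ x₅ x₆ x₇ x₀ x₁
  :∨ P x₃ x₄ x₅ x₆ x₇ x₀ x₁ x₂
  :∨ P x₄ x₅ x₆ x₇ x₀ x₁ x₂ x₃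
  :∨ P x₅ x₆ x₇ x₀ x₁ x₂ x₃ x₄
  :∨ P x₆ x₇ x₀ x₁ x₂ x₃ x₄ x₅
  :∨ P x₇ x₀ x₁ x₂ x₃ x₄ x₅ x₆

Around : (Vec A 8 → Set) → Vec A 8 → Set
Around P (x₀ ∷ x₁ ∷ x₂ ∷ x₃ ∷ x₄ ∷ x₅ ∷ x₆ ∷ x₇ ∷ []) =
    P (x₀ ∷ x₁ ∷ x₂ ∷ x₃ ∷ x₄ ∷ x₅ ∷ x₆ ∷ x₇ ∷ [])
  ⊎ P (x₁ ∷ x₂ ∷ x₃ ∷ x₄ ∷ x₅ ∷ x₆ ∷ x₇ ∷ x₀ ∷ [])
  ⊎ P (x₂ ∷ x₃ ∷ x₄ ∷ x₅ ∷ x₆ ∷ x₇ ∷ x₀ ∷ x₁ ∷ [])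
  ⊎ P (x₃ ∷ x₄ ∷ x₅ ∷ x₆ ∷ x₇ ∷ x₀ ∷ x₁ ∷ x₂ ∷ [])
  ⊎ P (x₄ ∷ x₅ ∷ x₆ ∷ x₇ ∷ x₀ ∷ x₁ ∷ x₂ ∷ x₃ ∷ [])
  ⊎ P (x₅ ∷ x₆ ∷ x₇ ∷ x₀ ∷ x₁ ∷ x₂ ∷ x₃ ∷ x₄ ∷ [])
  ⊎ P (x₆ ∷ x₇ ∷ x₀ ∷ x₁ ∷ x₂ ∷ x₃ ∷ x₄ ∷ x₅ ∷ [])
  ⊎ P (x₇ ∷ x₀ ∷ x₁ ∷ x₂ ∷ x₃ ∷ x₄ ∷ x₅ ∷ x₆ ∷ [])

pattern at₀ p = inj₁ p
pattern at₁ p = inj₂ (inj₁ p)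
pattern at₂ p = inj₂ (inj₂ (inj₁ p))
pattern at₃ p = inj₂ (inj₂ (inj₂ (inj₁ p)))
pattern at₄ p = inj₂ (inj₂ (inj₂ (inj₂ (inj₁ p))))
pattern at₅ p = inj₂ (inj₂ (inj₂ (inj₂ (inj₂ (inj₁ p)))))
pattern at₆ p = inj₂ (inj₂ (inj₂ (inj₂ (inj₂ (inj₂ (inj₁ p))))))
pattern at₇ p = inj₂ (inj₂ (inj₂ (inj₂ (inj₂ (inj₂ (inj₂ p))))))

Orbit⇒Around : ∀ {xs} → Orbit P xs → Around P xs
Orbit⇒Around = Orbit-elim unturn first
  where
  first : ∀ xs → P xs → Around P xs
  first (_ ∷ _ ∷ _ ∷ _ ∷ _ ∷ _ ∷ _ ∷ _ ∷ []) = at₀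
  unturn : ∀ xs → Around P (turn xs) → Around P xs
  unturn (_ ∷ _ ∷ _ ∷ _ ∷ _ ∷ _ ∷ _ ∷ _ ∷ []) = λ where
    (at₀ p) → at₁ p
    (at₁ p) → at₂ p
    (at₂ p) → at₃ p
    (at₃ p) → at₄ p
    (at₄ p) → at₅ p
    (at₅ p) → at₆ p
    (at₆ p) → at₇ p
    (at₇ p) → at₀ p

-- A tub is family8 M a b with M = x₁, a = x₂ and b = x₆; seven is the result of a move that empties x₀.
tub exceptional winning seven target : Predicate
tub x₀ x₁ x₂ x₃ x₄ x₅ x₆ x₇ =
     x₀ :≡ con 1
  :∧ con 1 :≤ x₂ :∧ con 1 :≤ x₃ :∧ con 1 :≤ x₄ :∧ con 1 :≤ x₅ :∧ con 1 :≤ x₆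
  :∧ x₇ :≡ x₁ :∧ x₂ :+ x₃ :≡ con 1 :+ x₁ :∧ x₅ :+ x₆ :≡ con 1 :+ x₁
  :∧ x₄ :≤ x₁ :∧ x₄ :< x₂ :+ x₆ :∧ (x₁ :≤ x₄ :∨ x₂ :+ x₆ :≤ con 1 :+ x₄)
exceptional x₀ x₁ x₂ x₃ x₄ x₅ x₆ x₇ =
     x₀ :≡ con 1 :∧ con 1 :≤ x₂ :∧ x₃ :≡ x₂ :∧ x₅ :≡ x₂ :∧ x₆ :≡ x₂
  :∧ con 1 :+ x₁ :≡ x₂ :+ x₂ :∧ x₄ :≡ x₁ :∧ x₇ :≡ x₁
winning x₀ x₁ x₂ x₃ x₄ x₅ x₆ x₇ =
  tub x₀ x₁ x₂ x₃ x₄ x₅ x₆ x₇ :∧ (exceptional x₀ x₁ x₂ x₃ x₄ x₅ x₆ x₇ :⇒ :⊥)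
seven x₀ x₁ x₂ x₃ x₄ x₅ x₆ x₇ =
     x₀ :≡ con 0 :∧ con 1 :≤ x₁
  :∧ x₂ :≡ x₁ :∧ x₃ :≡ x₁ :∧ x₄ :≡ x₁ :∧ x₅ :≡ x₁ :∧ x₆ :≡ x₁ :∧ x₇ :≡ x₁
target x₀ x₁ x₂ x₃ x₄ x₅ x₆ x₇ =
  winning x₀ x₁ x₂ x₃ x₄ x₅ x₆ x₇ :∨ seven x₀ x₁ x₂ x₃ x₄ x₅ x₆ x₇

below : (x₀ x₁ x₂ x₃ x₄ x₅ x₆ x₇ z₀ z₁ z₂ z₃ z₄ z₅ z₆ z₇ : Term) → Formula
below x₀ x₁ x₂ x₃ x₄ x₅ x₆ x₇ z₀ z₁ z₂ z₃ z₄ z₅ z₆ z₇ =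
  z₀ :≤ x₀ :∧ z₁ :≤ x₁ :∧ z₂ :≤ x₂ :∧ z₃ :≤ x₃ :∧ z₄ :≤ x₄ :∧ z₅ :≤ x₅ :∧ z₆ :≤ x₆ :∧ z₇ :≤ x₇

kept : (x₀ x₁ x₂ x₃ x₄ x₅ x₆ x₇ z₀ z₁ z₂ z₃ z₄ z₅ z₆ z₇ : Term) → Formula
kept x₀ x₁ x₂ x₃ x₄ x₅ x₆ x₇ z₀ z₁ z₂ z₃ z₄ z₅ z₆ z₇ =
     (z₀ :≡ x₀ :∧ z₁ :≡ x₁) :∨ (z₁ :≡ x₁ :∧ z₂ :≡ x₂) :∨ (z₂ :≡ x₂ :∧ z₃ :≡ x₃) :∨ (z₃ :≡ x₃ :∧ z₄ :≡ x₄)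
  :∨ (z₄ :≡ x₄ :∧ z₅ :≡ x₅) :∨ (z₅ :≡ x₅ :∧ z₆ :≡ x₆) :∨ (z₆ :≡ x₆ :∧ z₇ :≡ x₇) :∨ (z₇ :≡ x₇ :∧ z₀ :≡ x₀)

Below : Octet → Octet → Set
Below (x₀ ∷ x₁ ∷ x₂ ∷ x₃ ∷ x₄ ∷ x₅ ∷ x₆ ∷ x₇ ∷ []) (z₀ ∷ z₁ ∷ z₂ ∷ z₃ ∷ z₄ ∷ z₅ ∷ z₆ ∷ z₇ ∷ []) =
  z₀ ≤ x₀ × z₁ ≤ x₁ × z₂ ≤ x₂ × z₃ ≤ x₃ × z₄ ≤ x₄ × z₅ ≤ x₅ × z₆ ≤ x₆ × z₇ ≤ x₇

-- Applied to a zipped pair of octets, `Around Kept` unfolds to the meaning of the formula `kept`: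
-- some two adjacent piles are untouched.
Kept : Vec (ℕ × ℕ) 8 → Set
Kept ((x₀ , z₀) ∷ (x₁ , z₁) ∷ _) = z₀ ≡ x₀ × z₁ ≡ x₁

Below-turn : ∀ xs zs → Below xs zs → Below (turn xs) (turn zs)
Below-turn (_ ∷ _ ∷ _ ∷ _ ∷ _ ∷ _ ∷ _ ∷ _ ∷ []) (_ ∷ _ ∷ _ ∷ _ ∷ _ ∷ _ ∷ _ ∷ _ ∷ [])
  (p₀ , p₁ , p₂ , p₃ , p₄ , p₅ , p₆ , p₇) = p₁ , p₂ , p₃ , p₄ , p₅ , p₆ , p₇ , p₀

zip-turn : ∀ (xs zs : Octet) → turn (zip xs zs) ≡ zip (turn xs) (turn zs)
zip-turn (_ ∷ _ ∷ _ ∷ _ ∷ _ ∷ _ ∷ _ ∷ _ ∷ []) (_ ∷ _ ∷ _ ∷ _ ∷ _ ∷ _ ∷ _ ∷ _ ∷ []) = refl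

-- Comparison of targets lying one below the other

-- A tub located elsewhere with a pile of size 1 at x₀ is also a tub located at x₀, so that two tubs one of
-- which lies below the other may be assumed to have the same location.
tub-align : _
tub-align = solve 8 (λ x₀ x₁ x₂ x₃ x₄ x₅ x₆ x₇ →
  around winning x₀ x₁ x₂ x₃ x₄ x₅ x₆ x₇ :⇒ x₀ :≤ con 1 :⇒ tub x₀ x₁ x₂ x₃ x₄ x₅ x₆ x₇) refl

-- If x₁ is not lowered, the fixed sums x₂ + x₃ and x₅ + x₆ leave no room for any change. If it is
-- lowered, the kept pair must contain x₄ together with x₃ or x₅. Keeping x₃ lowers x₂, and keeping
-- x₅ lowers x₆, so both terms of the minimum giving x₄ decrease and x₄ is not kept after all. Sums
-- are compared because a move decreases the sum.
tub-minimal : _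
tub-minimal = solve 16 (λ x₀ x₁ x₂ x₃ x₄ x₅ x₆ x₇ z₀ z₁ z₂ z₃ z₄ z₅ z₆ z₇ →
  tub x₀ x₁ x₂ x₃ x₄ x₅ x₆ x₇ :⇒ tub z₀ z₁ z₂ z₃ z₄ z₅ z₆ z₇ :⇒
  below x₀ x₁ x₂ x₃ x₄ x₅ x₆ x₇ z₀ z₁ z₂ z₃ z₄ z₅ z₆ z₇ :⇒
  kept x₀ x₁ x₂ x₃ x₄ x₅ x₆ x₇ z₀ z₁ z₂ z₃ z₄ z₅ z₆ z₇ :⇒
  x₀ :+ (x₁ :+ (x₂ :+ (x₃ :+ (x₄ :+ (x₅ :+ (x₆ :+ (x₇ :+ con 0))))))) :≤
  z₀ :+ (z₁ :+ (z₂ :+ (z₃ :+ (z₄ :+ (z₅ :+ (z₆ :+ (z₇ :+ con 0)))))))) refl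

-- `winning` excludes the exception only at the location of the tub. This suffices: for p ≥ 2 the
-- exception has a single pile of size 1, and for p = 1 all piles are 1.
tub-exceptional : _
tub-exceptional = solve 8 (λ x₀ x₁ x₂ x₃ x₄ x₅ x₆ x₇ →
  tub x₀ x₁ x₂ x₃ x₄ x₅ x₆ x₇ :⇒ around exceptional x₀ x₁ x₂ x₃ x₄ x₅ x₆ x₇ :⇒
  exceptional x₀ x₁ x₂ x₃ x₄ x₅ x₆ x₇) refl

-- Let v be the common value. If v = 1, two adjacent piles of size 1 force a tub of ones. If v ≥ 2,
-- the pile x₀ is the emptied one and all others are at least v. Then x₁ = v would make another pile
-- 1, and x₄ = v is too small for its minimum, so x₂ = x₃ = v or x₅ = x₆ = v, which fixes all piles.
tub-seven : _
tub-seven = solve 16 (λ x₀ x₁ x₂ x₃ x₄ x₅ x₆ x₇ z₀ z₁ z₂ z₃ z₄ z₅ z₆ z₇ →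
  around seven z₀ z₁ z₂ z₃ z₄ z₅ z₆ z₇ :⇒ tub x₀ x₁ x₂ x₃ x₄ x₅ x₆ x₇ :⇒
  below x₀ x₁ x₂ x₃ x₄ x₅ x₆ x₇ z₀ z₁ z₂ z₃ z₄ z₅ z₆ z₇ :⇒
  kept x₀ x₁ x₂ x₃ x₄ x₅ x₆ x₇ z₀ z₁ z₂ z₃ z₄ z₅ z₆ z₇ :⇒
  exceptional x₀ x₁ x₂ x₃ x₄ x₅ x₆ x₇) refl

target-flip : _
target-flip = solve 8 (λ x₀ x₁ x₂ x₃ x₄ x₅ x₆ x₇ →
  target x₀ x₁ x₂ x₃ x₄ x₅ x₆ x₇ :⇒ target x₀ x₇ x₆ x₅ x₄ x₃ x₂ x₁) refl

tub-flip : _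
tub-flip = solve 8 (λ x₀ x₁ x₂ x₃ x₄ x₅ x₆ x₇ →
  tub x₀ x₁ x₂ x₃ x₄ x₅ x₆ x₇ :⇒ tub x₀ x₇ x₆ x₅ x₄ x₃ x₂ x₁) refl

exceptional-flip : _
exceptional-flip = solve 8 (λ x₀ x₁ x₂ x₃ x₄ x₅ x₆ x₇ →
  exceptional x₀ x₁ x₂ x₃ x₄ x₅ x₆ x₇ :⇒ exceptional x₀ x₇ x₆ x₅ x₄ x₃ x₂ x₁) refl

sum-turn : _
sum-turn = solve 8 (λ x₀ x₁ x₂ x₃ x₄ x₅ x₆ x₇ →
  x₁ :+ (x₂ :+ (x₃ :+ (x₄ :+ (x₅ :+ (x₆ :+ (x₇ :+ (x₀ :+ con 0))))))) :≡
  x₀ :+ (x₁ :+ (x₂ :+ (x₃ :+ (x₄ :+ (x₅ :+ (x₆ :+ (x₇ :+ con 0)))))))) refl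

total : Octet → ℕ
total (x₀ ∷ x₁ ∷ x₂ ∷ x₃ ∷ x₄ ∷ x₅ ∷ x₆ ∷ x₇ ∷ []) = x₀ + (x₁ + (x₂ + (x₃ + (x₄ + (x₅ + (x₆ + (x₇ + 0)))))))

total-turn : ∀ xs → total (turn xs) ≡ total xs
total-turn (x₀ ∷ x₁ ∷ x₂ ∷ x₃ ∷ x₄ ∷ x₅ ∷ x₆ ∷ x₇ ∷ []) = sum-turn x₀ x₁ x₂ x₃ x₄ x₅ x₆ x₇

target-split : ∀ {xs} → Orbit (holds target) xs → Orbit (holds winning) xs ⊎ Orbit (holds seven) xs
target-split (here (inj₁ w)) = inj₁ (here w)
target-split (here (inj₂ s)) = inj₂ (here s)
target-split (there o)       = [ inj₁ ∘ there , inj₂ ∘ there ]′ (target-split o)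

Stable : Octet → Set
Stable xs = ∀ zs → Below xs zs → Orbit Kept (zip xs zs) → Orbit (holds target) zs → total xs ≤ total zs

winning-stable : ∀ {xs} → Orbit (holds winning) xs → Stable xs
winning-stable = Orbit-elim unturn stable
  where
  unturn : ∀ xs → Stable (turn xs) → Stable xs
  unturn xs h zs b k t = subst₂ _≤_ (total-turn xs) (total-turn zs)
    (h (turn zs) (Below-turn xs zs b) (subst (Orbit Kept) (zip-turn xs zs) (Orbit-turn k)) (Orbit-turn t))
  stable : ∀ xs → holds winning xs → Stable xs
  stable (x₀ ∷ x₁ ∷ x₂ ∷ x₃ ∷ x₄ ∷ x₅ ∷ x₆ ∷ x₇ ∷ []) (tub-x , regular)
    (z₀ ∷ z₁ ∷ z₂ ∷ z₃ ∷ z₄ ∷ z₅ ∷ z₆ ∷ z₇ ∷ []) b k t with target-split t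
  ... | inj₁ w = tub-minimal x₀ x₁ x₂ x₃ x₄ x₅ x₆ x₇ z₀ z₁ z₂ z₃ z₄ z₅ z₆ z₇ tub-x
    (tub-align z₀ z₁ z₂ z₃ z₄ z₅ z₆ z₇ (Orbit⇒Around w) (≤-trans (proj₁ b) (≤-reflexive (proj₁ tub-x))))
    b (Orbit⇒Around k)
  ... | inj₂ s = ⊥-elim (regular (tub-seven x₀ x₁ x₂ x₃ x₄ x₅ x₆ x₇ z₀ z₁ z₂ z₃ z₄ z₅ z₆ z₇
    (Orbit⇒Around s) tub-x b (Orbit⇒Around k)))

winning-regular : ∀ {xs} → Orbit (holds winning) xs → ¬ Orbit (holds exceptional) xs
winning-regular = Orbit-elim {Q = λ xs → ¬ Orbit (holds exceptional) xs} (λ _ h → h ∘ Orbit-turn) λ where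
  (x₀ ∷ x₁ ∷ x₂ ∷ x₃ ∷ x₄ ∷ x₅ ∷ x₆ ∷ x₇ ∷ []) (tub-x , regular) e →
    regular (tub-exceptional x₀ x₁ x₂ x₃ x₄ x₅ x₆ x₇ tub-x (Orbit⇒Around e))

-- Positions from which a target can be reached

-- `zs` may equal `xs`; in that case the position is itself a target. This lets one search serve
-- both claimed and unclaimed positions.
Good : Octet → Set
Good xs = ∃ λ zs → Below xs zs × Orbit Kept (zip xs zs) × Orbit (holds target) zs

Good-turn : ∀ xs → Good (turn xs) → Good xs
Good-turn (_ ∷ _ ∷ _ ∷ _ ∷ _ ∷ _ ∷ _ ∷ _ ∷ []) (z₀ ∷ z₁ ∷ z₂ ∷ z₃ ∷ z₄ ∷ z₅ ∷ z₆ ∷ z₇ ∷ [] ,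
  (p₀ , p₁ , p₂ , p₃ , p₄ , p₅ , p₆ , p₇) , k , t) =
  z₇ ∷ z₀ ∷ z₁ ∷ z₂ ∷ z₃ ∷ z₄ ∷ z₅ ∷ z₆ ∷ [] , (p₇ , p₀ , p₁ , p₂ , p₃ , p₄ , p₅ , p₆) , there k , there t

Good-flip : ∀ xs → Good (flip xs) → Good xs
Good-flip (_ ∷ _ ∷ _ ∷ _ ∷ _ ∷ _ ∷ _ ∷ _ ∷ []) (zs@(_ ∷ _ ∷ _ ∷ _ ∷ _ ∷ _ ∷ _ ∷ _ ∷ []) ,
  (p₀ , p₁ , p₂ , p₃ , p₄ , p₅ , p₆ , p₇) , k , t) =
  flip zs , (p₀ , p₇ , p₆ , p₅ , p₄ , p₃ , p₂ , p₁) , Orbit-flip kept-flip k , Orbit-flip flip-target t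
  where
  kept-flip : ∀ ps → Kept ps → Orbit Kept (flip ps)
  kept-flip (_ ∷ _ ∷ _ ∷ _ ∷ _ ∷ _ ∷ _ ∷ _ ∷ []) (p , q) =
    there (there (there (there (there (there (there (here (q , p))))))))
  flip-target : ∀ xs → holds target xs → Orbit (holds target) (flip xs)
  flip-target (x₀ ∷ x₁ ∷ x₂ ∷ x₃ ∷ x₄ ∷ x₅ ∷ x₆ ∷ x₇ ∷ []) h = here (target-flip x₀ x₁ x₂ x₃ x₄ x₅ x₆ x₇ h)

-- Moves to a tub, in terms of the pile sizes minus 1

-- Whether a tub (0,m,…,m) located at y₀ lies below, apart from the conditions m ≤ y₁ and m ≤ y₇.
fits : Term → Predicate
fits m y₀ y₁ y₂ y₃ y₄ y₅ y₆ y₇ =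
  m :≤ y₂ :+ y₃ :∧ m :≤ y₃ :+ y₄ :∧ m :≤ y₄ :+ y₅ :∧ m :≤ y₅ :+ y₆ :∧
  (m :≤ y₄ :∨ m :+ m :≤ y₃ :+ y₄ :+ y₅)

-- d = m ∸ y and r = m ⊓ y
truncated : (m y d r : Term) → Formula
truncated m y d r = d :+ r :≡ m :∧ r :≤ y :∧ (d :≡ con 0 :∨ r :≡ y)

minimum : (m n e : Term) → Formula
minimum m n e = e :≤ m :∧ e :≤ n :∧ (m :≤ e :∨ n :≤ e)

predecessor : (n p : Term) → Formula
predecessor n p = (p :≡ con 0 :∧ n :≡ con 0) :∨ n :≡ con 1 :+ p

-- The formulas contain only sums, so differences, minima and predecessors enter them as extra
-- variables with defining relations. The witnesses come from here and from the next two functions.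
truncate : ∀ m y → ∃₂ λ d r → d + r ≡ m × r ≤ y × (d ≡ 0 ⊎ r ≡ y)
truncate m y with ≤-total m y
... | inj₁ m≤y = 0 , m , refl , m≤y , inj₁ refl
... | inj₂ y≤m = m ∸ y , y , m∸n+n≡m y≤m , ≤-refl , inj₂ refl

minimise : ∀ m n → ∃ λ e → e ≤ m × e ≤ n × (m ≤ e ⊎ n ≤ e)
minimise m n with ≤-total m n
... | inj₁ m≤n = m , ≤-refl , m≤n , inj₁ ≤-refl
... | inj₂ n≤m = n , n≤m , ≤-refl , inj₂ ≤-refl

precede : ∀ n → ∃ λ p → (p ≡ 0 × n ≡ 0) ⊎ n ≡ suc p
precede zero    = 0 , inj₁ (refl , refl)
precede (suc n) = n , inj₂ refl

-- In sizes minus 1 the tub is (0,m,a,a′,e,b′,b,m) with e = min(m, a + b), and it is exceptional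
-- exactly when a, a′, b and b′ are equal. The two adjacent pairs missing from the list are mirror
-- images of the first two.
moveTo : (m a a′ b b′ e : Term) → Predicate
moveTo m a a′ b b′ e y₀ y₁ y₂ y₃ y₄ y₅ y₆ y₇ =
     m :≤ y₁ :∧ a :≤ y₂ :∧ a′ :≤ y₃ :∧ e :≤ y₄ :∧ b′ :≤ y₅ :∧ b :≤ y₆ :∧ m :≤ y₇
  :∧ a :+ a′ :≡ m :∧ b :+ b′ :≡ m :∧ minimum m (a :+ b) e
  :∧ (a :≡ a′ :⇒ a :≡ b :⇒ a :≡ b′ :⇒ :⊥)
  :∧ (   (y₀ :≡ con 0 :∧ m :≡ y₁) :∨ (m :≡ y₁ :∧ a :≡ y₂) :∨ (a :≡ y₂ :∧ a′ :≡ y₃) :∨ (a′ :≡ y₃ :∧ e :≡ y₄)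
      :∨ (e :≡ y₄ :∧ b′ :≡ y₅) :∨ (b′ :≡ y₅ :∧ b :≡ y₆))

-- The piles other than y₀ can be reduced to v, while y₀ is emptied.
collapse : (v : Term) → Predicate
collapse v y₀ y₁ y₂ y₃ y₄ y₅ y₆ y₇ =
     v :≤ y₁ :∧ v :≤ y₂ :∧ v :≤ y₃ :∧ v :≤ y₄ :∧ v :≤ y₅ :∧ v :≤ y₆ :∧ v :≤ y₇
  :∧ (   (v :≡ y₁ :∧ v :≡ y₂) :∨ (v :≡ y₂ :∧ v :≡ y₃) :∨ (v :≡ y₃ :∧ v :≡ y₄)
      :∨ (v :≡ y₄ :∧ v :≡ y₅) :∨ (v :≡ y₅ :∧ v :≡ y₆) :∨ (v :≡ y₆ :∧ v :≡ y₇))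

Options : Octet → Set
Options ys = Good (Vec.map suc ys)

moveTo-option : ∀ {y₀ y₁ y₂ y₃ y₄ y₅ y₆ y₇} m a a′ b b′ e →
  ⟦ moveTo (var 8) (var 9) (var 10) (var 11) (var 12) (var 13) (var 0) (var 1) (var 2) (var 3) (var 4) (var 5) (var 6) (var 7) ⟧
    (y₀ ∷ y₁ ∷ y₂ ∷ y₃ ∷ y₄ ∷ y₅ ∷ y₆ ∷ y₇ ∷ m ∷ a ∷ a′ ∷ b ∷ b′ ∷ e ∷ []) →
  Options (y₀ ∷ y₁ ∷ y₂ ∷ y₃ ∷ y₄ ∷ y₅ ∷ y₆ ∷ y₇ ∷ [])
moveTo-option {y₀} {y₁} {y₂} {y₃} {y₄} {y₅} {y₆} {y₇} m a a′ b b′ e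
  h@(p₁ , p₂ , p₃ , p₄ , p₅ , p₆ , p₇ , s , s′ , lo , reg , k) =
  1 ∷ suc m ∷ suc a ∷ suc a′ ∷ suc e ∷ suc b′ ∷ suc b ∷ suc m ∷ [] ,
  (s≤s z≤n , s≤s p₁ , s≤s p₂ , s≤s p₃ , s≤s p₄ , s≤s p₅ , s≤s p₆ , s≤s p₇) ,
  kept-option k , here (inj₁ (shape m a a′ b b′ e s s′ lo reg))
  where
  shape : _
  shape = solve 6 (λ m a a′ b b′ e → a :+ a′ :≡ m :⇒ b :+ b′ :≡ m :⇒ minimum m (a :+ b) e :⇒
    (a :≡ a′ :⇒ a :≡ b :⇒ a :≡ b′ :⇒ :⊥) :⇒
    winning (con 1) (con 1 :+ m) (con 1 :+ a) (con 1 :+ a′) (con 1 :+ e) (con 1 :+ b′) (con 1 :+ b) (con 1 :+ m)) refl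
  kept-option : _ → Orbit Kept _
  kept-option (at₀ (q , r)) = here (cong suc (sym q) , cong suc r)
  kept-option (at₁ (q , r)) = there (here (cong suc q , cong suc r))
  kept-option (at₂ (q , r)) = there (there (here (cong suc q , cong suc r)))
  kept-option (at₃ (q , r)) = there (there (there (here (cong suc q , cong suc r))))
  kept-option (at₄ (q , r)) = there (there (there (there (here (cong suc q , cong suc r)))))
  kept-option (inj₂ (inj₂ (inj₂ (inj₂ (inj₂ (q , r)))))) =
    there (there (there (there (there (here (cong suc q , cong suc r))))))

collapse-option : ∀ {y₀ y₁ y₂ y₃ y₄ y₅ y₆ y₇} v →
  ⟦ collapse (var 8) (var 0) (var 1) (var 2) (var 3) (var 4) (var 5) (var 6) (var 7) ⟧
    (y₀ ∷ y₁ ∷ y₂ ∷ y₃ ∷ y₄ ∷ y₅ ∷ y₆ ∷ y₇ ∷ v ∷ []) →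
  Options (y₀ ∷ y₁ ∷ y₂ ∷ y₃ ∷ y₄ ∷ y₅ ∷ y₆ ∷ y₇ ∷ [])
collapse-option v (p₁ , p₂ , p₃ , p₄ , p₅ , p₆ , p₇ , k) =
  0 ∷ suc v ∷ suc v ∷ suc v ∷ suc v ∷ suc v ∷ suc v ∷ suc v ∷ [] ,
  (z≤n , s≤s p₁ , s≤s p₂ , s≤s p₃ , s≤s p₄ , s≤s p₅ , s≤s p₆ , s≤s p₇) ,
  kept-option k , here (inj₂ (refl , s≤s z≤n , refl , refl , refl , refl , refl , refl))
  where
  kept-option : _ → Orbit Kept _
  kept-option (at₀ (q , r)) = there (here (cong suc q , cong suc r))
  kept-option (at₁ (q , r)) = there (there (here (cong suc q , cong suc r)))
  kept-option (at₂ (q , r)) = there (there (there (here (cong suc q , cong suc r))))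
  kept-option (at₃ (q , r)) = there (there (there (there (here (cong suc q , cong suc r)))))
  kept-option (at₄ (q , r)) = there (there (there (there (there (here (cong suc q , cong suc r))))))
  kept-option (inj₂ (inj₂ (inj₂ (inj₂ (inj₂ (q , r)))))) =
    there (there (there (there (there (there (here (cong suc q , cong suc r)))))))

-- The largest m that fits is blocked by a pair of piles (saturated) or by the opposite pile y₄, which is
-- smaller than m (low) or equal to m (level).
saturated : _
saturated = solve 12 (λ y₀ y₁ y₂ y₃ y₄ y₅ y₆ y₇ m q q′ e →
  m :≤ y₁ :⇒ m :≤ y₇ :⇒ fits m y₀ y₁ y₂ y₃ y₄ y₅ y₆ y₇ :⇒ y₂ :+ y₃ :≡ m :⇒
  truncated m y₅ q q′ :⇒ minimum m (y₂ :+ q) e :⇒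
  moveTo m y₂ y₃ q q′ e y₀ y₁ y₂ y₃ y₄ y₅ y₆ y₇ :∨ collapse y₃ y₀ y₁ y₂ y₃ y₄ y₅ y₆ y₇) refl

fits-flip : _
fits-flip = solve 9 (λ y₀ y₁ y₂ y₃ y₄ y₅ y₆ y₇ m →
  fits m y₀ y₁ y₂ y₃ y₄ y₅ y₆ y₇ :⇒ fits m y₀ y₇ y₆ y₅ y₄ y₃ y₂ y₁) refl

-- If y₄ exceeded m, only the sums y₂ + y₃ and y₅ + y₆ could prevent 1 + m from fitting.
unsaturated : _
unsaturated = solve 9 (λ y₀ y₁ y₂ y₃ y₄ y₅ y₆ y₇ m →
  fits m y₀ y₁ y₂ y₃ y₄ y₅ y₆ y₇ :⇒ (fits (con 1 :+ m) y₀ y₁ y₂ y₃ y₄ y₅ y₆ y₇ :⇒ :⊥) :⇒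
  y₂ :+ y₃ :≡ m :∨ y₆ :+ y₅ :≡ m :∨ (m :< y₂ :+ y₃ :∧ m :< y₅ :+ y₆ :∧ (y₄ :< m :∨ y₄ :≡ m))) refl

-- The least a and b give e = p + q, and by maximality of m this is y₄ or one less. In the second
-- case raising b by one gives e = y₄. The pile y₄ is kept together with y₃ or y₅, and e < m rules
-- out the exception.
low : _
low = solve 16 (λ y₀ y₁ y₂ y₃ y₄ y₅ y₆ y₇ m p p′ q q′ s e₀ e₁ →
  m :≤ y₁ :⇒ m :≤ y₇ :⇒ fits m y₀ y₁ y₂ y₃ y₄ y₅ y₆ y₇ :⇒
  (fits (con 1 :+ m) y₀ y₁ y₂ y₃ y₄ y₅ y₆ y₇ :⇒ :⊥) :⇒ m :< y₂ :+ y₃ :⇒ m :< y₅ :+ y₆ :⇒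
  y₄ :< m :⇒ truncated m y₃ p p′ :⇒ truncated m y₅ q q′ :⇒ predecessor q′ s :⇒
  minimum m (p :+ q) e₀ :⇒ minimum m (p :+ (con 1 :+ q)) e₁ :⇒
     moveTo m p p′ q q′ e₀ y₀ y₁ y₂ y₃ y₄ y₅ y₆ y₇
  :∨ moveTo m p p′ (con 1 :+ q) s e₁ y₀ y₁ y₂ y₃ y₄ y₅ y₆ y₇) refl

level-split : _
level-split = solve 5 (λ m p p′ q q′ →
  (m :≤ p :+ q :∧ (p :≡ p′ :⇒ p :≡ q :⇒ p :≡ q′ :⇒ :⊥)) :∨ (p :≡ p′ :∧ p :≡ q :∧ p :≡ q′) :∨ p :+ q :< m) refl

level-regular : _
level-regular = solve 13 (λ y₀ y₁ y₂ y₃ y₄ y₅ y₆ y₇ m p p′ q q′ →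
  m :≤ y₁ :⇒ m :≤ y₇ :⇒ fits m y₀ y₁ y₂ y₃ y₄ y₅ y₆ y₇ :⇒
  (fits (con 1 :+ m) y₀ y₁ y₂ y₃ y₄ y₅ y₆ y₇ :⇒ :⊥) :⇒ m :< y₂ :+ y₃ :⇒ m :< y₅ :+ y₆ :⇒
  y₄ :≡ m :⇒ truncated m y₃ p p′ :⇒ truncated m y₅ q q′ :⇒
  m :≤ p :+ q :∧ (p :≡ p′ :⇒ p :≡ q :⇒ p :≡ q′ :⇒ :⊥) :⇒
  moveTo m p p′ q q′ m y₀ y₁ y₂ y₃ y₄ y₅ y₆ y₇) refl

-- For m > 0 raising b by one leaves e = m, and y₃ and y₄ are kept. For m = 0 maximality makes y₃ or
-- y₅ zero like y₄, and seven equal piles are reached.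
level-exceptional : _
level-exceptional = solve 14 (λ y₀ y₁ y₂ y₃ y₄ y₅ y₆ y₇ m p p′ q q′ s →
  m :≤ y₁ :⇒ m :≤ y₇ :⇒ fits m y₀ y₁ y₂ y₃ y₄ y₅ y₆ y₇ :⇒
  (fits (con 1 :+ m) y₀ y₁ y₂ y₃ y₄ y₅ y₆ y₇ :⇒ :⊥) :⇒ m :< y₂ :+ y₃ :⇒ m :< y₅ :+ y₆ :⇒
  y₄ :≡ m :⇒ truncated m y₃ p p′ :⇒ truncated m y₅ q q′ :⇒ p :≡ p′ :∧ p :≡ q :∧ p :≡ q′ :⇒
  predecessor q′ s :⇒
     moveTo m p p′ (con 1 :+ q) s m y₀ y₁ y₂ y₃ y₄ y₅ y₆ y₇
  :∨ collapse y₃ y₀ y₁ y₂ y₃ y₄ y₅ y₆ y₇ :∨ collapse y₅ y₀ y₁ y₂ y₃ y₄ y₅ y₆ y₇) refl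

-- Maximality of m forces p + q = m - 1, so raising either b or a by one yields e = m = y₄. The two
-- resulting tubs are not both exceptional.
level-short : _
level-short = solve 15 (λ y₀ y₁ y₂ y₃ y₄ y₅ y₆ y₇ m p p′ q q′ s r →
  m :≤ y₁ :⇒ m :≤ y₇ :⇒ fits m y₀ y₁ y₂ y₃ y₄ y₅ y₆ y₇ :⇒
  (fits (con 1 :+ m) y₀ y₁ y₂ y₃ y₄ y₅ y₆ y₇ :⇒ :⊥) :⇒ m :< y₂ :+ y₃ :⇒ m :< y₅ :+ y₆ :⇒
  y₄ :≡ m :⇒ truncated m y₃ p p′ :⇒ truncated m y₅ q q′ :⇒ p :+ q :< m :⇒
  predecessor q′ s :⇒ predecessor p′ r :⇒
     moveTo m p p′ (con 1 :+ q) s m y₀ y₁ y₂ y₃ y₄ y₅ y₆ y₇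
  :∨ moveTo m (con 1 :+ p) r q q′ m y₀ y₁ y₂ y₃ y₄ y₅ y₆ y₇
  :∨ collapse y₃ y₀ y₁ y₂ y₃ y₄ y₅ y₆ y₇) refl

Fits : ℕ → Octet → Set
Fits m ys = holds (fits (con m)) ys

blocked : ∀ ys m → let y = at (toList ys) in m ≤ y 1 → m ≤ y 7 → Fits m ys → ¬ Fits (suc m) ys → Options ys
blocked ys@(y₀ ∷ y₁ ∷ y₂ ∷ y₃ ∷ y₄ ∷ y₅ ∷ y₆ ∷ y₇ ∷ []) m m≤y₁ m≤y₇ f ¬f =
  go (unsaturated y₀ y₁ y₂ y₃ y₄ y₅ y₆ y₇ m f ¬f)
  where
  go : _ → Options ys
  go (inj₁ sat) =
    -- The pair y₂, y₃ is kept and b is chosen least. If this tub is exceptional, all piles but y₀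
    -- are at least y₃ and can be lowered to it.
    let q , q′ , tq = truncate m y₅; e , te = minimise m (y₂ + q) in
    [ moveTo-option m y₂ y₃ q q′ e , collapse-option y₃ ]′
      (saturated y₀ y₁ y₂ y₃ y₄ y₅ y₆ y₇ m q q′ e m≤y₁ m≤y₇ f sat tq te)
  go (inj₂ (inj₁ sat)) =
    let p , p′ , tp = truncate m y₃; e , te = minimise m (y₆ + p) in
    Good-flip (Vec.map suc ys) ([ moveTo-option m y₆ y₅ p p′ e , collapse-option y₅ ]′
      (saturated y₀ y₇ y₆ y₅ y₄ y₃ y₂ y₁ m p p′ e m≤y₇ m≤y₁
        (fits-flip y₀ y₁ y₂ y₃ y₄ y₅ y₆ y₇ m f) sat tp te))
  go (inj₂ (inj₂ (s₁ , s₂ , inj₁ y₄<m))) =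
    let p , p′ , tp = truncate m y₃; q , q′ , tq = truncate m y₅; s , ps = precede q′
        e₀ , te₀ = minimise m (p + q); e₁ , te₁ = minimise m (p + suc q) in
    [ moveTo-option m p p′ q q′ e₀ , moveTo-option m p p′ (suc q) s e₁ ]′
      (low y₀ y₁ y₂ y₃ y₄ y₅ y₆ y₇ m p p′ q q′ s e₀ e₁ m≤y₁ m≤y₇ f ¬f s₁ s₂ y₄<m tp tq ps te₀ te₁)
  go (inj₂ (inj₂ (s₁ , s₂ , inj₂ y₄≡m))) =
    let p , p′ , tp = truncate m y₃; q , q′ , tq = truncate m y₅; s , ps = precede q′; r , pr = precede p′ in
    [ (λ h → moveTo-option m p p′ q q′ m
        (level-regular y₀ y₁ y₂ y₃ y₄ y₅ y₆ y₇ m p p′ q q′ m≤y₁ m≤y₇ f ¬f s₁ s₂ y₄≡m tp tq h))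
    , [ (λ h → [ moveTo-option m p p′ (suc q) s m , [ collapse-option y₃ , collapse-option y₅ ]′ ]′
          (level-exceptional y₀ y₁ y₂ y₃ y₄ y₅ y₆ y₇ m p p′ q q′ s m≤y₁ m≤y₇ f ¬f s₁ s₂ y₄≡m tp tq h ps))
      , (λ h → [ moveTo-option m p p′ (suc q) s m , [ moveTo-option m (suc p) r q q′ m , collapse-option y₃ ]′ ]′
          (level-short y₀ y₁ y₂ y₃ y₄ y₅ y₆ y₇ m p p′ q q′ s r m≤y₁ m≤y₇ f ¬f s₁ s₂ y₄≡m tp tq h ps pr)) ]′ ]′
    (level-split m p p′ q q′)

-- Tubs limited by a neighbour of their smallest pile

-- What remains when m = y₁ ≤ y₇ is the largest size of a tub at y₀ and none of its choices leads to a move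
-- that keeps (y₀,y₁), (y₁,y₂), (y₃,y₄) or (y₄,y₅).
tight : Predicate
tight y₀ y₁ y₂ y₃ y₄ y₅ y₆ y₇ = y₁ :≤ y₇ :⇒
     con 1 :≤ y₀
  :∧ fits (con 1 :+ y₁) y₀ y₁ y₂ y₃ y₄ y₅ y₆ y₇
  :∧ (y₁ :< y₂ :∨ (y₄ :< y₁ :∧ (y₄ :< y₂ :∨ y₄ :+ y₅ :< y₂ :+ y₁)))
  :∧ (y₁ :< y₃ :∨ y₁ :≤ y₄ :∨ y₁ :+ y₆ :< y₃ :+ y₄)
  :∧ (y₁ :< y₅ :∨ y₁ :≤ y₄ :∨ y₁ :+ y₂ :< y₅ :+ y₄)

-- The negated conjuncts of `tight`, sorted by the pair to be kept; the pair y₀, y₁ is split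
-- according to whether y₁ is zero.
loose : _
loose = solve 8 (λ y₀ y₁ y₂ y₃ y₄ y₅ y₆ y₇ →
  fits (con 1 :+ y₁) y₀ y₁ y₂ y₃ y₄ y₅ y₆ y₇ :⇒ (tight y₀ y₁ y₂ y₃ y₄ y₅ y₆ y₇ :⇒ :⊥) :⇒
     (y₀ :≡ con 0 :∧ con 0 :≡ y₁) :∨ (y₀ :≡ con 0 :∧ con 1 :≤ y₁)
  :∨ (y₂ :≤ y₁ :∧ (y₁ :≤ y₄ :∨ (y₂ :≤ y₄ :∧ y₂ :+ y₁ :≤ y₄ :+ y₅)))
  :∨ (y₃ :≤ y₁ :∧ y₄ :< y₁ :∧ y₁ :≤ y₃ :+ y₄ :∧ y₃ :+ y₄ :≤ y₁ :+ y₆)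
  :∨ (y₅ :≤ y₁ :∧ y₄ :< y₁ :∧ y₁ :≤ y₅ :+ y₄ :∧ y₅ :+ y₄ :≤ y₁ :+ y₂)) refl

-- If the tub with least a and b is exceptional, the slack in `fits (1 + y₁)` allows a to be raised
-- by one.
keep₀₁ : _
keep₀₁ = solve 15 (λ y₀ y₁ y₂ y₃ y₄ y₅ y₆ y₇ p p′ q q′ r e₀ e₁ →
  y₁ :≤ y₇ :⇒ fits (con 1 :+ y₁) y₀ y₁ y₂ y₃ y₄ y₅ y₆ y₇ :⇒ y₀ :≡ con 0 :∧ con 1 :≤ y₁ :⇒
  truncated y₁ y₃ p p′ :⇒ truncated y₁ y₅ q q′ :⇒ predecessor p′ r :⇒
  minimum y₁ (p :+ q) e₀ :⇒ minimum y₁ (con 1 :+ p :+ q) e₁ :⇒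
     moveTo y₁ p p′ q q′ e₀ y₀ y₁ y₂ y₃ y₄ y₅ y₆ y₇
  :∨ moveTo y₁ (con 1 :+ p) r q q′ e₁ y₀ y₁ y₂ y₃ y₄ y₅ y₆ y₇) refl

keep₁₂-regular : _
keep₁₂-regular = solve 12 (λ y₀ y₁ y₂ y₃ y₄ y₅ y₆ y₇ a q q′ e →
  y₁ :≤ y₇ :⇒ fits (con 1 :+ y₁) y₀ y₁ y₂ y₃ y₄ y₅ y₆ y₇ :⇒
  y₁ :≤ y₄ :∨ (y₂ :≤ y₄ :∧ y₂ :+ y₁ :≤ y₄ :+ y₅) :⇒ y₂ :+ a :≡ y₁ :⇒
  truncated y₁ y₅ q q′ :⇒ minimum y₁ (y₂ :+ q) e :⇒
  (y₂ :≡ a :⇒ y₂ :≡ q :⇒ y₂ :≡ q′ :⇒ :⊥) :⇒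
  moveTo y₁ y₂ a q q′ e y₀ y₁ y₂ y₃ y₄ y₅ y₆ y₇) refl

-- An exceptional tub has e = m already, so raising b by one does not change e, and the slack in
-- `fits (1 + y₁)` provides the room at y₆.
keep₁₂-exceptional : _
keep₁₂-exceptional = solve 13 (λ y₀ y₁ y₂ y₃ y₄ y₅ y₆ y₇ a q q′ s e →
  y₁ :≤ y₇ :⇒ fits (con 1 :+ y₁) y₀ y₁ y₂ y₃ y₄ y₅ y₆ y₇ :⇒
  y₁ :≤ y₄ :∨ (y₂ :≤ y₄ :∧ y₂ :+ y₁ :≤ y₄ :+ y₅) :⇒ y₂ :+ a :≡ y₁ :⇒
  truncated y₁ y₅ q q′ :⇒ y₂ :≡ a :∧ y₂ :≡ q :∧ y₂ :≡ q′ :⇒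
  predecessor q′ s :⇒ minimum y₁ (y₂ :+ (con 1 :+ q)) e :⇒
  y₁ :≡ con 0 :∨ moveTo y₁ y₂ a (con 1 :+ q) s e y₀ y₁ y₂ y₃ y₄ y₅ y₆ y₇) refl

regular-split : _
regular-split = solve 4 (λ p p′ q q′ →
  (p :≡ p′ :⇒ p :≡ q :⇒ p :≡ q′ :⇒ :⊥) :∨ (p :≡ p′ :∧ p :≡ q :∧ p :≡ q′)) refl

-- Since e = y₄ < m, the minimum is a + b. Hence keeping y₃ and y₄ determines a and b, and the tub
-- is not exceptional.
keep₃₄ : _
keep₃₄ = solve 11 (λ y₀ y₁ y₂ y₃ y₄ y₅ y₆ y₇ a b b′ →
  y₁ :≤ y₇ :⇒ fits (con 1 :+ y₁) y₀ y₁ y₂ y₃ y₄ y₅ y₆ y₇ :⇒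
  y₄ :< y₁ :⇒ y₃ :+ y₄ :≤ y₁ :+ y₆ :⇒ y₃ :+ a :≡ y₁ :⇒ y₁ :+ b :≡ y₃ :+ y₄ :⇒ b :+ b′ :≡ y₁ :⇒
  moveTo y₁ a y₃ b b′ y₄ y₀ y₁ y₂ y₃ y₄ y₅ y₆ y₇) refl

keep₄₅ : _
keep₄₅ = solve 11 (λ y₀ y₁ y₂ y₃ y₄ y₅ y₆ y₇ a a′ b →
  y₁ :≤ y₇ :⇒ fits (con 1 :+ y₁) y₀ y₁ y₂ y₃ y₄ y₅ y₆ y₇ :⇒
  y₄ :< y₁ :⇒ y₅ :+ y₄ :≤ y₁ :+ y₂ :⇒ y₅ :+ b :≡ y₁ :⇒ y₁ :+ a :≡ y₅ :+ y₄ :⇒ a :+ a′ :≡ y₁ :⇒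
  moveTo y₁ a a′ b y₅ y₄ y₀ y₁ y₂ y₃ y₄ y₅ y₆ y₇) refl

sum-bound : ∀ a b c d → c ≤ d → b < d → d + a ≡ c + b → a ≤ d
sum-bound = solve 4 (λ a b c d → c :≤ d :⇒ b :< d :⇒ d :+ a :≡ c :+ b :⇒ a :≤ d) refl

-- Inconsistency of the tight systems

least : Predicate
least y₀ y₁ y₂ y₃ y₄ y₅ y₆ y₇ =
  y₀ :≤ y₁ :∧ y₀ :≤ y₂ :∧ y₀ :≤ y₃ :∧ y₀ :≤ y₄ :∧ y₀ :≤ y₅ :∧ y₀ :≤ y₆ :∧ y₀ :≤ y₇

-- The configuration is rotated so that y₀ is least; the least pile at odd distance from it is then, up to
-- reflection, y₁ (near) or y₃ (far).
near-contradiction : _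
near-contradiction = solve 8 (λ y₀ y₁ y₂ y₃ y₄ y₅ y₆ y₇ →
  least y₀ y₁ y₂ y₃ y₄ y₅ y₆ y₇ :⇒ y₁ :≤ y₃ :∧ y₁ :≤ y₅ :∧ y₁ :≤ y₇ :⇒
  tight y₄ y₃ y₂ y₁ y₀ y₇ y₆ y₅ :⇒
  tight y₄ y₅ y₆ y₇ y₀ y₁ y₂ y₃ :⇒
  tight y₇ y₀ y₁ y₂ y₃ y₄ y₅ y₆ :⇒
  :⊥) refl

-- Each `tight` is conditional on an order between two neighbours, and the inequalities won in one
-- stage discharge such conditions later: y₆ ≤ y₄ at y₅, then y₅ ≤ y₇ at y₆ and y₁ ≤ y₇ at y₀.
far-order₁ : _
far-order₁ = solve 8 (λ y₀ y₁ y₂ y₃ y₄ y₅ y₆ y₇ →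
  least y₀ y₁ y₂ y₃ y₄ y₅ y₆ y₇ :⇒ y₃ :≤ y₁ :∧ y₃ :≤ y₅ :∧ y₃ :≤ y₇ :⇒
  tight y₁ y₀ y₇ y₆ y₅ y₄ y₃ y₂ :⇒
  tight y₇ y₀ y₁ y₂ y₃ y₄ y₅ y₆ :⇒
  tight y₂ y₃ y₄ y₅ y₆ y₇ y₀ y₁ :⇒
  tight y₅ y₄ y₃ y₂ y₁ y₀ y₇ y₆ :⇒
  tight y₅ y₆ y₇ y₀ y₁ y₂ y₃ y₄ :⇒
  y₆ :≤ y₄ :∧ y₆ :≤ y₁) refl

far-order₂ : _
far-order₂ = solve 8 (λ y₀ y₁ y₂ y₃ y₄ y₅ y₆ y₇ →
  least y₀ y₁ y₂ y₃ y₄ y₅ y₆ y₇ :⇒ y₃ :≤ y₁ :∧ y₃ :≤ y₅ :∧ y₃ :≤ y₇ :⇒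
  y₆ :≤ y₄ :∧ y₆ :≤ y₁ :⇒
  tight y₆ y₇ y₀ y₁ y₂ y₃ y₄ y₅ :⇒
  tight y₄ y₃ y₂ y₁ y₀ y₇ y₆ y₅ :⇒
  tight y₅ y₆ y₇ y₀ y₁ y₂ y₃ y₄ :⇒
  tight y₀ y₇ y₆ y₅ y₄ y₃ y₂ y₁ :⇒
  y₅ :≤ y₇ :∧ y₆ :≤ y₇) refl

far-order₃ : _
far-order₃ = solve 8 (λ y₀ y₁ y₂ y₃ y₄ y₅ y₆ y₇ →
  least y₀ y₁ y₂ y₃ y₄ y₅ y₆ y₇ :⇒ y₃ :≤ y₁ :∧ y₃ :≤ y₅ :∧ y₃ :≤ y₇ :⇒
  y₆ :≤ y₄ :∧ y₆ :≤ y₁ :⇒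
  y₅ :≤ y₇ :∧ y₆ :≤ y₇ :⇒
  tight y₅ y₆ y₇ y₀ y₁ y₂ y₃ y₄ :⇒
  tight y₀ y₁ y₂ y₃ y₄ y₅ y₆ y₇ :⇒
  tight y₀ y₇ y₆ y₅ y₄ y₃ y₂ y₁ :⇒
  y₁ :≤ y₇ :∧ y₆ :≤ y₂) refl

far-contradiction : _
far-contradiction = solve 8 (λ y₀ y₁ y₂ y₃ y₄ y₅ y₆ y₇ →
  least y₀ y₁ y₂ y₃ y₄ y₅ y₆ y₇ :⇒ y₃ :≤ y₁ :∧ y₃ :≤ y₅ :∧ y₃ :≤ y₇ :⇒
  y₆ :≤ y₄ :∧ y₆ :≤ y₁ :⇒
  y₅ :≤ y₇ :∧ y₆ :≤ y₇ :⇒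
  y₁ :≤ y₇ :∧ y₆ :≤ y₂ :⇒
  tight y₁ y₀ y₇ y₆ y₅ y₄ y₃ y₂ :⇒
  tight y₇ y₀ y₁ y₂ y₃ y₄ y₅ y₆ :⇒
  tight y₀ y₁ y₂ y₃ y₄ y₅ y₆ y₇ :⇒
  tight y₃ y₄ y₅ y₆ y₇ y₀ y₁ y₂ :⇒
  tight y₆ y₅ y₄ y₃ y₂ y₁ y₀ y₇ :⇒
  tight y₃ y₂ y₁ y₀ y₇ y₆ y₅ y₄ :⇒
  :⊥) refl

-- Search over positions and orientations

boundary : ∀ ys n → Fits (suc n) ys ⊎ ∃ λ m → m ≤ n × Fits m ys × ¬ Fits (suc m) ys
boundary ys zero with holds? (fits (con 1)) ys
... | yes f = inj₁ f
... | no ¬f = inj₂ (0 , z≤n , (z≤n , z≤n , z≤n , z≤n , inj₁ z≤n) , ¬f)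
boundary ys (suc n) with boundary ys n
... | inj₂ (m , m≤n , f) = inj₂ (m , m≤n⇒m≤1+n m≤n , f)
... | inj₁ f with holds? (fits (con (2 + n))) ys
...   | yes f′ = inj₁ f′
...   | no ¬f′ = inj₂ (suc n , ≤-refl , f , ¬f′)

turns : ℕ → Octet → Octet
turns zero    ys = ys
turns (suc k) ys = turns k (turn ys)

map-turn : ∀ ys → Vec.map suc (turn ys) ≡ turn (Vec.map suc ys)
map-turn (_ ∷ _ ∷ _ ∷ _ ∷ _ ∷ _ ∷ _ ∷ _ ∷ []) = refl

map-flip : ∀ ys → Vec.map suc (flip ys) ≡ flip (Vec.map suc ys)
map-flip (_ ∷ _ ∷ _ ∷ _ ∷ _ ∷ _ ∷ _ ∷ _ ∷ []) = refl

Options-turn : ∀ ys → Options (turn ys) → Options ys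
Options-turn ys g = Good-turn _ (subst Good (map-turn ys) g)

Options-flip : ∀ ys → Options (flip ys) → Options ys
Options-flip ys g = Good-flip _ (subst Good (map-flip ys) g)

Options-turns : ∀ k ys → Options (turns k ys) → Options ys
Options-turns zero    ys g = g
Options-turns (suc k) ys g = Options-turn ys (Options-turns k (turn ys) g)

tight? : ∀ ys → Options ys ⊎ holds tight ys
tight? ys@(y₀ ∷ y₁ ∷ y₂ ∷ y₃ ∷ y₄ ∷ y₅ ∷ y₆ ∷ y₇ ∷ []) with holds? tight ys
... | yes t = inj₂ t
... | no ¬t with y₁ ≤? y₇
...   | no  y₁≰y₇ = contradiction (λ y₁≤y₇ → contradiction y₁≤y₇ y₁≰y₇) ¬t
...   | yes y₁≤y₇ with boundary ys y₁
...     | inj₂ (m , m≤y₁ , f , ¬f) = inj₁ (blocked ys m m≤y₁ (≤-trans m≤y₁ y₁≤y₇) f ¬f)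
...     | inj₁ f = inj₁ (go (loose y₀ y₁ y₂ y₃ y₄ y₅ y₆ y₇ f ¬t))
  where
  go : _ → Options ys
  -- Turning by four makes y₄ the emptied pile, so the zero pair y₀, y₁ can be the kept one.
  go (at₀ (y₀≡0 , 0≡y₁)) = Options-turns 4 ys (collapse-option 0
    (z≤n , z≤n , z≤n , z≤n , z≤n , z≤n , z≤n , inj₂ (inj₂ (inj₂ (inj₁ (sym y₀≡0 , 0≡y₁))))))
  go (at₁ h) =
    let p , p′ , tp = truncate y₁ y₃; q , q′ , tq = truncate y₁ y₅; r , pr = precede p′
        e₀ , te₀ = minimise y₁ (p + q); e₁ , te₁ = minimise y₁ (suc p + q) in
    [ moveTo-option y₁ p p′ q q′ e₀ , moveTo-option y₁ (suc p) r q q′ e₁ ]′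
      (keep₀₁ y₀ y₁ y₂ y₃ y₄ y₅ y₆ y₇ p p′ q q′ r e₀ e₁ y₁≤y₇ f h tp tq pr te₀ te₁)
  go (at₂ (y₂≤y₁ , h)) =
    let a , ta = m≤n⇒∃[o]m+o≡n y₂≤y₁; q , q′ , tq = truncate y₁ y₅; s , ps = precede q′
        e₀ , te₀ = minimise y₁ (y₂ + q); e₁ , te₁ = minimise y₁ (y₂ + suc q) in
    [ (λ r → moveTo-option y₁ y₂ a q q′ e₀
        (keep₁₂-regular y₀ y₁ y₂ y₃ y₄ y₅ y₆ y₇ a q q′ e₀ y₁≤y₇ f h ta tq te₀ r))
    , (λ x → [ (λ y₁≡0 → collapse-option 0 (z≤n , z≤n , z≤n , z≤n , z≤n , z≤n , z≤n ,
                   inj₁ (sym y₁≡0 , sym (n≤0⇒n≡0 (subst (y₂ ≤_) y₁≡0 y₂≤y₁)))))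
             , moveTo-option y₁ y₂ a (suc q) s e₁ ]′
        (keep₁₂-exceptional y₀ y₁ y₂ y₃ y₄ y₅ y₆ y₇ a q q′ s e₁ y₁≤y₇ f h ta tq x ps te₁)) ]′
    (regular-split y₂ a q q′)
  go (at₃ (y₃≤y₁ , y₄<y₁ , lo , hi)) =
    let a , ta = m≤n⇒∃[o]m+o≡n y₃≤y₁; b , tb = m≤n⇒∃[o]m+o≡n lo
        b′ , tb′ = m≤n⇒∃[o]m+o≡n (sum-bound b y₄ y₃ y₁ y₃≤y₁ y₄<y₁ tb) in
    moveTo-option y₁ a y₃ b b′ y₄ (keep₃₄ y₀ y₁ y₂ y₃ y₄ y₅ y₆ y₇ a b b′ y₁≤y₇ f y₄<y₁ hi ta tb tb′)
  go (inj₂ (inj₂ (inj₂ (inj₂ (y₅≤y₁ , y₄<y₁ , lo , hi))))) =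
    let b , tb = m≤n⇒∃[o]m+o≡n y₅≤y₁; a , ta = m≤n⇒∃[o]m+o≡n lo
        a′ , ta′ = m≤n⇒∃[o]m+o≡n (sum-bound a y₄ y₅ y₁ y₅≤y₁ y₄<y₁ ta) in
    moveTo-option y₁ a a′ b y₅ y₄ (keep₄₅ y₀ y₁ y₂ y₃ y₄ y₅ y₆ y₇ a a′ b y₁≤y₇ f y₄<y₁ hi tb ta ta′)

-- Either a failing system already yields the goal, or the system becomes a hypothesis of the
-- continuation.
assume⁺ : ∀ k ys → (holds tight (turns k ys) → Options ys) → Options ys
assume⁺ k ys c = [ Options-turns k ys , c ]′ (tight? (turns k ys))

assume⁻ : ∀ k ys → (holds tight (flip (turns k ys)) → Options ys) → Options ys
assume⁻ k ys c = [ Options-turns k ys ∘ Options-flip (turns k ys) , c ]′ (tight? (flip (turns k ys)))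

near : ∀ ys → let y = at (toList ys) in holds least ys → y 1 ≤ y 3 × y 1 ≤ y 5 × y 1 ≤ y 7 → Options ys
near ys@(y₀ ∷ y₁ ∷ y₂ ∷ y₃ ∷ y₄ ∷ y₅ ∷ y₆ ∷ y₇ ∷ []) l o =
  assume⁻ 4 ys λ t₀ →
  assume⁺ 4 ys λ t₁ →
  assume⁺ 7 ys λ t₂ →
  ⊥-elim (near-contradiction y₀ y₁ y₂ y₃ y₄ y₅ y₆ y₇ l o t₀ t₁ t₂)

far : ∀ ys → let y = at (toList ys) in holds least ys → y 3 ≤ y 1 × y 3 ≤ y 5 × y 3 ≤ y 7 → Options ys
far ys@(y₀ ∷ y₁ ∷ y₂ ∷ y₃ ∷ y₄ ∷ y₅ ∷ y₆ ∷ y₇ ∷ []) l o =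
  assume⁻ 1 ys λ t₁⁻ → assume⁺ 7 ys λ t₇⁺ →
  assume⁺ 2 ys λ t₂⁺ → assume⁻ 5 ys λ t₅⁻ →
  assume⁺ 5 ys λ t₅⁺ → assume⁺ 6 ys λ t₆⁺ →
  assume⁻ 4 ys λ t₄⁻ → assume⁻ 0 ys λ t₀⁻ →
  assume⁺ 0 ys λ t₀⁺ → assume⁺ 3 ys λ t₃⁺ →
  assume⁻ 6 ys λ t₆⁻ → assume⁻ 3 ys λ t₃⁻ →
  let
    o₁ = far-order₁ y₀ y₁ y₂ y₃ y₄ y₅ y₆ y₇ l o t₁⁻ t₇⁺ t₂⁺ t₅⁻ t₅⁺
    o₂ = far-order₂ y₀ y₁ y₂ y₃ y₄ y₅ y₆ y₇ l o o₁ t₆⁺ t₄⁻ t₅⁺ t₀⁻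
    o₃ = far-order₃ y₀ y₁ y₂ y₃ y₄ y₅ y₆ y₇ l o o₁ o₂ t₅⁺ t₀⁺ t₀⁻
  in ⊥-elim (far-contradiction y₀ y₁ y₂ y₃ y₄ y₅ y₆ y₇ l o o₁ o₂ o₃ t₁⁻ t₇⁺ t₀⁺ t₃⁺ t₆⁻ t₃⁻)

least-odd : ∀ a b c d → (a ≤ b × a ≤ c × a ≤ d) ⊎ (b ≤ a × b ≤ c × b ≤ d) ⊎ (c ≤ b × c ≤ a × c ≤ d) ⊎ (d ≤ c × d ≤ b × d ≤ a)
least-odd = solve 4 (λ a b c d →
     (a :≤ b :∧ a :≤ c :∧ a :≤ d) :∨ (b :≤ a :∧ b :≤ c :∧ b :≤ d)
  :∨ (c :≤ b :∧ c :≤ a :∧ c :≤ d) :∨ (d :≤ c :∧ d :≤ b :∧ d :≤ a)) refl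

least-options : ∀ ys → holds least ys → Options ys
least-options ys@(y₀ ∷ y₁ ∷ y₂ ∷ y₃ ∷ y₄ ∷ y₅ ∷ y₆ ∷ y₇ ∷ []) l@(l₁ , l₂ , l₃ , l₄ , l₅ , l₆ , l₇) =
  go (least-odd y₁ y₃ y₅ y₇)
  where
  l′ = l₇ , l₆ , l₅ , l₄ , l₃ , l₂ , l₁
  go : _ → Options ys
  go (inj₁ o)               = near ys l o
  go (inj₂ (inj₁ o))        = far ys l o
  go (inj₂ (inj₂ (inj₁ (o₃ , o₁ , o₇)))) = Options-flip ys (far (flip ys) l′ (o₇ , o₃ , o₁))
  go (inj₂ (inj₂ (inj₂ o))) = Options-flip ys (near (flip ys) l′ o)

-- The game

private variable
  ws xs : List ℕ
  v : ℕ

-- Removal of stones and of empty piles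

pointwise-sum : Pointwise _≤_ ws xs → ws ≡ xs ⊎ sum ws < sum xs
pointwise-sum [] = inj₁ refl
pointwise-sum (z≤x ∷ ps) with m≤n⇒m<n∨m≡n z≤x | pointwise-sum ps
... | inj₁ z<x  | inj₁ refl = inj₂ (+-mono-<-≤ z<x ≤-refl)
... | inj₁ z<x  | inj₂ lt   = inj₂ (+-mono-< z<x lt)
... | inj₂ refl | inj₁ refl = inj₁ refl
... | inj₂ refl | inj₂ lt   = inj₂ (+-monoʳ-< _ lt)

removeZeros-length : ∀ zs → length (removeZeros zs) ≤ length zs
removeZeros-length []           = z≤n
removeZeros-length (zero ∷ zs)  = m≤n⇒m≤1+n (removeZeros-length zs)
removeZeros-length (suc _ ∷ zs) = s≤s (removeZeros-length zs)

removeZeros-full : ∀ zs → length (removeZeros zs) ≡ length zs → removeZeros zs ≡ zs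
removeZeros-full []           eq = refl
removeZeros-full (zero ∷ zs)  eq = contradiction (removeZeros-length zs) (<⇒≱ (≤-reflexive (sym eq)))
removeZeros-full (suc z ∷ zs) eq = cong (suc z ∷_) (removeZeros-full zs (suc-injective eq))

removeZeros-empty : ∀ zs → removeZeros zs ≡ [] → ∀ i → at zs i ≡ 0
removeZeros-empty []          eq i       = refl
removeZeros-empty (zero ∷ zs) eq zero    = refl
removeZeros-empty (zero ∷ zs) eq (suc i) = removeZeros-empty zs eq i

removeZeros-positive : ∀ zs → All (0 <_) (removeZeros zs)
removeZeros-positive []           = []
removeZeros-positive (zero ∷ zs)  = removeZeros-positive zs
removeZeros-positive (suc _ ∷ zs) = s≤s z≤n ∷ removeZeros-positive zs

removeZeros-id : All (0 <_) xs → removeZeros xs ≡ xs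
removeZeros-id []             = refl
removeZeros-id (s≤s _ ∷ ps) = cong (_ ∷_) (removeZeros-id ps)

removeZeros-sum : ∀ zs → sum (removeZeros zs) ≡ sum zs
removeZeros-sum []           = refl
removeZeros-sum (zero ∷ zs)  = removeZeros-sum zs
removeZeros-sum (suc z ∷ zs) = cong (_+_ (suc z)) (removeZeros-sum zs)

removeZeros-single : ∀ n zs → length zs ≡ suc n → removeZeros zs ≡ replicate n v →
  ∃₂ λ us vs → zs ≡ us ++ 0 ∷ vs × us ++ vs ≡ replicate n v
removeZeros-single n (zero ∷ zs) len eq = [] , zs , refl , trans (sym (removeZeros-full zs full)) eq
  where full = trans (trans (cong length eq) (length-replicate n)) (sym (suc-injective len))
removeZeros-single (suc n) (suc z ∷ zs) len eq =
  let us , vs , p , q = removeZeros-single n zs (suc-injective len) (∷-injectiveʳ eq)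
  in suc z ∷ us , vs , cong (suc z ∷_) p , cong₂ _∷_ (∷-injectiveˡ eq) q

-- Cyclic equivalence and the claimed family

rotate-length : ∀ i (xs : List ℕ) → length (rotate i xs) ≡ length xs
rotate-length i xs = begin
  length (drop i xs ++ take i xs)            ≡⟨ length-++ (drop i xs) ⟩
  length (drop i xs) + length (take i xs)    ≡⟨ +-comm (length (drop i xs)) _ ⟩
  length (take i xs) + length (drop i xs)    ≡⟨ length-++ (take i xs) ⟨
  length (take i xs ++ drop i xs)            ≡⟨ cong length (take++drop≡id i xs) ⟩
  length xs                                  ∎
  where open ≡-Reasoning

≈c-length : xs ≈c ws → length ws ≡ length xs
≈c-length {xs} (i , inj₁ refl) = rotate-length i xs
≈c-length {xs} (i , inj₂ refl) = trans (rotate-length i (reverse xs)) (length-reverse xs)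

asOctet : ∀ xs → length xs ≡ 8 → ∃ λ (ys : Octet) → xs ≡ toList ys
asOctet (x₀ ∷ x₁ ∷ x₂ ∷ x₃ ∷ x₄ ∷ x₅ ∷ x₆ ∷ x₇ ∷ []) refl = x₀ ∷ x₁ ∷ x₂ ∷ x₃ ∷ x₄ ∷ x₅ ∷ x₆ ∷ x₇ ∷ [] , refl

≈c-orbit : ∀ {P : Octet → Set} xs ds → (∀ ws → P ws → P (flip ws)) → toList xs ≈c toList ds → P ds → Orbit P xs
≈c-orbit (x₀ ∷ x₁ ∷ x₂ ∷ x₃ ∷ x₄ ∷ x₅ ∷ x₆ ∷ x₇ ∷ []) (d₀ ∷ d₁ ∷ d₂ ∷ d₃ ∷ d₄ ∷ d₅ ∷ d₆ ∷ d₇ ∷ []) f = go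
  where
  go : _ → _ → _
  go (0 , inj₁ refl) p = here p
  go (1 , inj₁ refl) p = there (here p)
  go (2 , inj₁ refl) p = there (there (here p))
  go (3 , inj₁ refl) p = there (there (there (here p)))
  go (4 , inj₁ refl) p = there (there (there (there (here p))))
  go (5 , inj₁ refl) p = there (there (there (there (there (here p)))))
  go (6 , inj₁ refl) p = there (there (there (there (there (there (here p))))))
  go (7 , inj₁ refl) p = there (there (there (there (there (there (there (here p)))))))
  -- From index 8 on, `drop` leaves nothing and `take` everything, so `rotate` is the identity.
  go (suc (suc (suc (suc (suc (suc (suc (suc i))))))) , inj₁ eq) p
    rewrite take-[] {A = ℕ} i | drop-[] {A = ℕ} i with refl ← eq = here p
  -- Reversal followed by rotation by 7 is `flip`; rotation by a smaller i is `flip` after 7 - i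
  -- turns.
  go (7 , inj₂ refl) p = here (f _ p)
  go (6 , inj₂ refl) p = there (here (f _ p))
  go (5 , inj₂ refl) p = there (there (here (f _ p)))
  go (4 , inj₂ refl) p = there (there (there (here (f _ p))))
  go (3 , inj₂ refl) p = there (there (there (there (here (f _ p)))))
  go (2 , inj₂ refl) p = there (there (there (there (there (here (f _ p))))))
  go (1 , inj₂ refl) p = there (there (there (there (there (there (here (f _ p)))))))
  go (0 , inj₂ refl) p = there (there (there (there (there (there (there (here (f _ p))))))))
  go (suc (suc (suc (suc (suc (suc (suc (suc i))))))) , inj₂ eq) p
    rewrite take-[] {A = ℕ} i | drop-[] {A = ℕ} i with refl ← eq =
    there (there (there (there (there (there (there (here (f _ p))))))))

orbit-≈c : ∀ {P : Octet → Set} xs → Orbit P xs → ∃ λ ds → P ds × toList xs ≈c toList ds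
orbit-≈c xs@(_ ∷ _ ∷ _ ∷ _ ∷ _ ∷ _ ∷ _ ∷ _ ∷ []) o with Orbit⇒Around o
... | at₀ p = _ , p , 0 , inj₁ refl
... | at₁ p = _ , p , 1 , inj₁ refl
... | at₂ p = _ , p , 2 , inj₁ refl
... | at₃ p = _ , p , 3 , inj₁ refl
... | at₄ p = _ , p , 4 , inj₁ refl
... | at₅ p = _ , p , 5 , inj₁ refl
... | at₆ p = _ , p , 6 , inj₁ refl
... | at₇ p = _ , p , 7 , inj₁ refl

Familiar Exceptional : Config → Set
Familiar c = ∃ λ M → ∃ λ a → ∃ λ b → 1 ≤ a × a ≤ M × 1 ≤ b × b ≤ M × c ≡ family8 M a b
Exceptional c = ∃ λ p → 1 ≤ p × c ≡ exception8 p

complement : ∀ M a c → a + c ≡ suc M → 1 ≤ c → c ≡ M ∸ a + 1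
complement M a (suc c) eq (s≤s z≤n) with refl ← suc-injective (trans (sym (+-suc a c)) eq) =
  trans (+-comm 1 c) (cong (_+ 1) (sym (m+n∸m≡n a c)))

minimum-⊓ : ∀ e m n → e ≤ m → e ≤ n → m ≤ e ⊎ n ≤ e → e ≡ m ⊓ n
minimum-⊓ e m n e≤m e≤n (inj₁ m≤e) = ≤-antisym (⊓-glb e≤m e≤n) (≤-trans (m⊓n≤m m n) m≤e)
minimum-⊓ e m n e≤m e≤n (inj₂ n≤e) = ≤-antisym (⊓-glb e≤m e≤n) (≤-trans (m⊓n≤n m n) n≤e)

⊓-minimum : ∀ m n → m ⊓ n ≤ m × m ⊓ n ≤ n × (m ≤ m ⊓ n ⊎ n ≤ m ⊓ n)
⊓-minimum m n = m⊓n≤m m n , m⊓n≤n m n , Sum.map (≤-reflexive ∘ sym) (≤-reflexive ∘ sym) (⊓-sel m n)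

tub-bounds : _
tub-bounds = solve 3 (λ x₁ x₂ x₃ → x₂ :+ x₃ :≡ con 1 :+ x₁ :⇒ con 1 :≤ x₃ :⇒ x₂ :≤ x₁) refl

tub⇒family : ∀ ws → holds tub ws → Familiar (toList ws)
tub⇒family (x₀ ∷ x₁ ∷ x₂ ∷ x₃ ∷ x₄ ∷ x₅ ∷ x₆ ∷ x₇ ∷ []) (refl , p₂ , p₃ , p₄ , p₅ , p₆ , refl , s , s′ , lo , lo′ , hi) =
  x₁ , x₂ , x₆ , p₂ , tub-bounds x₁ x₂ x₃ s p₃ , p₆ , tub-bounds x₁ x₆ x₅ t p₅ ,
  cong₂ (λ a′ ys → 1 ∷ x₁ ∷ x₂ ∷ a′ ∷ ys) (complement x₁ x₂ x₃ s p₃)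
    (cong₂ (λ e b′ → e ∷ b′ ∷ x₆ ∷ x₁ ∷ [])
      (minimum-⊓ x₄ x₁ _ lo (∸-monoˡ-≤ 1 lo′) (Sum.map₂ (∸-monoˡ-≤ 1) hi))
      (complement x₁ x₆ x₅ t p₅))
  where t = trans (+-comm x₆ x₅) s′

family-tub : _
family-tub = solve 7 (λ M a b d d′ n e → d :+ a :≡ M :⇒ d′ :+ b :≡ M :⇒ con 1 :≤ a :⇒ con 1 :≤ b :⇒
  n :+ con 1 :≡ a :+ b :⇒ minimum M n e :⇒
  tub (con 1) M a (d :+ con 1) e (d′ :+ con 1) b M) refl

familyOctet : ℕ → ℕ → ℕ → Octet
familyOctet M a b =
  1 ∷ M ∷ a ∷ (M ∸ a + 1) ∷ (M ⊓ (a + b ∸ 1)) ∷ (M ∸ b + 1) ∷ b ∷ M ∷ []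

family⇒tub : ∀ {M a b} → 1 ≤ a → a ≤ M → 1 ≤ b → b ≤ M → holds tub (familyOctet M a b)
family⇒tub {M} {a} {b} 1≤a a≤M 1≤b b≤M =
  family-tub M a b (M ∸ a) (M ∸ b) (a + b ∸ 1) (M ⊓ (a + b ∸ 1)) (m∸n+n≡m a≤M) (m∸n+n≡m b≤M) 1≤a 1≤b
    (m∸n+n≡m (≤-trans 1≤a (m≤m+n a b))) (⊓-minimum M _)

exceptionOctet : ℕ → Octet
exceptionOctet p = 1 ∷ (2 * p ∸ 1) ∷ p ∷ p ∷ (2 * p ∸ 1) ∷ p ∷ p ∷ (2 * p ∸ 1) ∷ []

exceptional⇒exception : ∀ ws → holds exceptional ws → Exceptional (toList ws)
exceptional⇒exception (x₀ ∷ x₁ ∷ x₂ ∷ x₃ ∷ x₄ ∷ x₅ ∷ x₆ ∷ x₇ ∷ []) (refl , 1≤p , refl , refl , refl , eq , refl , refl)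
  with refl ← trans (cong pred eq) (cong (λ q → x₂ + q ∸ 1) (sym (+-identityʳ x₂))) = x₂ , 1≤p , refl

exception-exceptional : _
exception-exceptional = solve 2 (λ p m → con 1 :≤ p :⇒ m :+ con 1 :≡ p :+ (p :+ con 0) :⇒
  exceptional (con 1) m p p m p p m) refl

exception⇒exceptional : ∀ {p} → 1 ≤ p → holds exceptional (exceptionOctet p)
exception⇒exceptional {p} 1≤p = exception-exceptional p (2 * p ∸ 1) 1≤p (m∸n+n≡m (≤-trans 1≤p (m≤m+n p _)))

Claimed₈ : Config → Set
Claimed₈ c = (∃ λ M → ∃ λ a → ∃ λ b → 1 ≤ a × a ≤ M × 1 ≤ b × b ≤ M × c ≈c family8 M a b)
           × ((p : ℕ) → 1 ≤ p → c ≈c exception8 p → ⊥)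

tub-flips : ∀ ws → holds tub ws → holds tub (flip ws)
tub-flips (x₀ ∷ x₁ ∷ x₂ ∷ x₃ ∷ x₄ ∷ x₅ ∷ x₆ ∷ x₇ ∷ []) = tub-flip x₀ x₁ x₂ x₃ x₄ x₅ x₆ x₇

exceptional-flips : ∀ ws → holds exceptional ws → holds exceptional (flip ws)
exceptional-flips (x₀ ∷ x₁ ∷ x₂ ∷ x₃ ∷ x₄ ∷ x₅ ∷ x₆ ∷ x₇ ∷ []) = exceptional-flip x₀ x₁ x₂ x₃ x₄ x₅ x₆ x₇

winning⇒claimed : ∀ xs → Orbit (holds winning) xs → Claimed₈ (toList xs)
winning⇒claimed xs w with orbit-≈c xs w
... | ds , (t , _) , c≈ds with tub⇒family ds t
...   | M , a , b , 1≤a , a≤M , 1≤b , b≤M , eq =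
  (M , a , b , 1≤a , a≤M , 1≤b , b≤M , subst (toList xs ≈c_) eq c≈ds) ,
  λ p 1≤p c≈ → winning-regular w (≈c-orbit xs (exceptionOctet p) exceptional-flips c≈ (exception⇒exceptional 1≤p))

claimed⇒winning : ∀ xs → Claimed₈ (toList xs) → Orbit (holds winning) xs
claimed⇒winning xs ((M , a , b , 1≤a , a≤M , 1≤b , b≤M , c≈) , regular) =
  refine (≈c-orbit xs (familyOctet M a b) tub-flips c≈ (family⇒tub 1≤a a≤M 1≤b b≤M)) λ e →
    let ds , h , c≈ds = orbit-≈c xs e; p , 1≤p , eq = exceptional⇒exception ds h
    in regular p 1≤p (subst (toList xs ≈c_) eq c≈ds)
  where
  refine : ∀ {xs} → Orbit (holds tub) xs → ¬ Orbit (holds exceptional) xs → Orbit (holds winning) xs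
  refine (here t)  n = here (t , n ∘ here)
  refine (there o) n = there (refine o (n ∘ there))

argmin : ∀ x xs → ∃ λ u → u < suc (length xs) × All (at (x ∷ xs) u ≤_) (x ∷ xs)
argmin x []       = 0 , s≤s z≤n , ≤-refl ∷ []
argmin x (y ∷ xs) with argmin y xs
... | u , u< , ps with ≤-total x (at (y ∷ xs) u)
...   | inj₁ x≤ = 0 , s≤s z≤n , ≤-refl ∷ All.map (≤-trans x≤) ps
...   | inj₂ ≤x = suc u , s≤s u< , ≤x ∷ ps

replicate-below : All (v ≤_) xs → Pointwise _≤_ (replicate (length xs) v) xs
replicate-below []       = []
replicate-below (p ∷ ps) = p ∷ replicate-below ps

at-replicate : ∀ n {i} → i < n → at (replicate n v) i ≡ v
at-replicate (suc n) {zero}  _         = refl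
at-replicate (suc n) {suc i} (s≤s i<n) = at-replicate n i<n

at-positive : All (0 <_) xs → ∀ {i} → i < length xs → 0 < at xs i
at-positive (p ∷ ps) {zero}  _       = p
at-positive (p ∷ ps) {suc i} (s≤s l) = at-positive ps l

rotate-options : ∀ ys u → u < 8 → All (at (toList ys) u ≤_) (toList ys) → Options ys
rotate-options ys@(_ ∷ _ ∷ _ ∷ _ ∷ _ ∷ _ ∷ _ ∷ _ ∷ []) = λ where
  0 _ (p₀ ∷ p₁ ∷ p₂ ∷ p₃ ∷ p₄ ∷ p₅ ∷ p₆ ∷ p₇ ∷ []) → Options-turns 0 ys (least-options (turns 0 ys) (p₁ , p₂ , p₃ , p₄ , p₅ , p₆ , p₇))
  1 _ (p₀ ∷ p₁ ∷ p₂ ∷ p₃ ∷ p₄ ∷ p₅ ∷ p₆ ∷ p₇ ∷ []) → Options-turns 1 ys (least-options (turns 1 ys) (p₂ , p₃ , p₄ , p₅ , p₆ , p₇ , p₀))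
  2 _ (p₀ ∷ p₁ ∷ p₂ ∷ p₃ ∷ p₄ ∷ p₅ ∷ p₆ ∷ p₇ ∷ []) → Options-turns 2 ys (least-options (turns 2 ys) (p₃ , p₄ , p₅ , p₆ , p₇ , p₀ , p₁))
  3 _ (p₀ ∷ p₁ ∷ p₂ ∷ p₃ ∷ p₄ ∷ p₅ ∷ p₆ ∷ p₇ ∷ []) → Options-turns 3 ys (least-options (turns 3 ys) (p₄ , p₅ , p₆ , p₇ , p₀ , p₁ , p₂))
  4 _ (p₀ ∷ p₁ ∷ p₂ ∷ p₃ ∷ p₄ ∷ p₅ ∷ p₆ ∷ p₇ ∷ []) → Options-turns 4 ys (least-options (turns 4 ys) (p₅ , p₆ , p₇ , p₀ , p₁ , p₂ , p₃))
  5 _ (p₀ ∷ p₁ ∷ p₂ ∷ p₃ ∷ p₄ ∷ p₅ ∷ p₆ ∷ p₇ ∷ []) → Options-turns 5 ys (least-options (turns 5 ys) (p₆ , p₇ , p₀ , p₁ , p₂ , p₃ , p₄))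
  6 _ (p₀ ∷ p₁ ∷ p₂ ∷ p₃ ∷ p₄ ∷ p₅ ∷ p₆ ∷ p₇ ∷ []) → Options-turns 6 ys (least-options (turns 6 ys) (p₇ , p₀ , p₁ , p₂ , p₃ , p₄ , p₅))
  7 _ (p₀ ∷ p₁ ∷ p₂ ∷ p₃ ∷ p₄ ∷ p₅ ∷ p₆ ∷ p₇ ∷ []) → Options-turns 7 ys (least-options (turns 7 ys) (p₀ , p₁ , p₂ , p₃ , p₄ , p₅ , p₆))
  (suc (suc (suc (suc (suc (suc (suc (suc u)))))))) u<8 _ → contradiction (m≤m+n 8 u) (<⇒≱ u<8)

octet-options : ∀ ys → Options ys
octet-options ys@(y₀ ∷ y₁ ∷ y₂ ∷ y₃ ∷ y₄ ∷ y₅ ∷ y₆ ∷ y₇ ∷ []) =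
  let u , u<8 , ps = argmin y₀ (y₁ ∷ y₂ ∷ y₃ ∷ y₄ ∷ y₅ ∷ y₆ ∷ y₇ ∷ []) in rotate-options ys u u<8 ps

-- Windows of six piles

inWindow? : ∀ k r s i → Dec (InWindow k r s i)
inWindow? k r s i = _ <? k

-- These four facts are finite checks by evaluation. A window starting at s misses just the position
-- s + 6 among seven, and the adjacent positions s + 6 and s + 7 among eight; conversely it is
-- started right after the piles to be kept.
covers₇ : ∀ {u} → u < 7 → ∀ {i} → i < 7 → i ≡ u ⊎ InWindow 6 7 (suc u % 7) i
covers₇ = toWitness {a? = allUpTo? (λ u → allUpTo? (λ i → i ≟ u ⊎-dec inWindow? 6 7 (suc u % 7) i) 7) 7} tt

avoids₇ : ∀ {s} → s < 7 → ¬ InWindow 6 7 s ((s + 6) % 7)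
avoids₇ = toWitness {a? = allUpTo? (λ s → ¬? (inWindow? 6 7 s ((s + 6) % 7))) 7} tt

covers₈ : ∀ {u} → u < 8 → ∀ {i} → i < 8 → i ≡ u ⊎ i ≡ suc u % 8 ⊎ InWindow 6 8 ((2 + u) % 8) i
covers₈ = toWitness {a? = allUpTo? (λ u → allUpTo? (λ i →
  i ≟ u ⊎-dec i ≟ suc u % 8 ⊎-dec inWindow? 6 8 ((2 + u) % 8) i) 8) 8} tt

avoids₈ : ∀ {s} → s < 8 → let u = (s + 6) % 8 in ¬ InWindow 6 8 s u × ¬ InWindow 6 8 s (suc u % 8)
avoids₈ = toWitness {a? = allUpTo? (λ s → let u = (s + 6) % 8 in
  ¬? (inWindow? 6 8 s u) ×-dec ¬? (inWindow? 6 8 s (suc u % 8))) 8} tt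

KeptAt : Octet → Octet → ℕ → Set
KeptAt xs zs u = at (toList zs) u ≡ at (toList xs) u × at (toList zs) (suc u % 8) ≡ at (toList xs) (suc u % 8)

kept⇒keptAt : ∀ xs zs → Orbit Kept (zip xs zs) → ∃ λ u → u < 8 × KeptAt xs zs u
kept⇒keptAt (_ ∷ _ ∷ _ ∷ _ ∷ _ ∷ _ ∷ _ ∷ _ ∷ []) (_ ∷ _ ∷ _ ∷ _ ∷ _ ∷ _ ∷ _ ∷ _ ∷ []) k with Orbit⇒Around k
... | at₀ p = 0 , <ᵇ⇒< 0 8 tt , p
... | at₁ p = 1 , <ᵇ⇒< 1 8 tt , p
... | at₂ p = 2 , <ᵇ⇒< 2 8 tt , p
... | at₃ p = 3 , <ᵇ⇒< 3 8 tt , p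
... | at₄ p = 4 , <ᵇ⇒< 4 8 tt , p
... | at₅ p = 5 , <ᵇ⇒< 5 8 tt , p
... | at₆ p = 6 , <ᵇ⇒< 6 8 tt , p
... | at₇ p = 7 , <ᵇ⇒< 7 8 tt , p

keptAt⇒kept : ∀ xs zs u → u < 8 → KeptAt xs zs u → Orbit Kept (zip xs zs)
keptAt⇒kept (_ ∷ _ ∷ _ ∷ _ ∷ _ ∷ _ ∷ _ ∷ _ ∷ []) (_ ∷ _ ∷ _ ∷ _ ∷ _ ∷ _ ∷ _ ∷ _ ∷ []) = λ where
  0 _ p → here p
  1 _ p → there (here p)
  2 _ p → there (there (here p))
  3 _ p → there (there (there (here p)))
  4 _ p → there (there (there (there (here p))))
  5 _ p → there (there (there (there (there (here p)))))
  6 _ p → there (there (there (there (there (there (here p))))))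
  7 _ p → there (there (there (there (there (there (there (here p)))))))
  (suc (suc (suc (suc (suc (suc (suc (suc u)))))))) u<8 _ → contradiction (m≤m+n 8 u) (<⇒≱ u<8)

below⇒pointwise : ∀ xs zs → Below xs zs → Pointwise _≤_ (toList zs) (toList xs)
below⇒pointwise (_ ∷ _ ∷ _ ∷ _ ∷ _ ∷ _ ∷ _ ∷ _ ∷ []) (_ ∷ _ ∷ _ ∷ _ ∷ _ ∷ _ ∷ _ ∷ _ ∷ [])
  (p₀ , p₁ , p₂ , p₃ , p₄ , p₅ , p₆ , p₇) = p₀ ∷ p₁ ∷ p₂ ∷ p₃ ∷ p₄ ∷ p₅ ∷ p₆ ∷ p₇ ∷ []

pointwise⇒below : ∀ xs zs → Pointwise _≤_ (toList zs) (toList xs) → Below xs zs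
pointwise⇒below (_ ∷ _ ∷ _ ∷ _ ∷ _ ∷ _ ∷ _ ∷ _ ∷ []) (_ ∷ _ ∷ _ ∷ _ ∷ _ ∷ _ ∷ _ ∷ _ ∷ [])
  (p₀ ∷ p₁ ∷ p₂ ∷ p₃ ∷ p₄ ∷ p₅ ∷ p₆ ∷ p₇ ∷ []) = p₀ , p₁ , p₂ , p₃ , p₄ , p₅ , p₆ , p₇

toList-length : ∀ (xs : Octet) → length (toList xs) ≡ 8
toList-length (_ ∷ _ ∷ _ ∷ _ ∷ _ ∷ _ ∷ _ ∷ _ ∷ []) = refl

winning-positive : ∀ {xs} → Orbit (holds winning) xs → All (0 <_) (toList xs)
winning-positive = Orbit-elim {Q = λ xs → All (0 <_) (toList xs)} unturn positive
  where
  unturn : ∀ xs → All (0 <_) (toList (turn xs)) → All (0 <_) (toList xs)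
  unturn (_ ∷ _ ∷ _ ∷ _ ∷ _ ∷ _ ∷ _ ∷ _ ∷ []) (p₁ ∷ p₂ ∷ p₃ ∷ p₄ ∷ p₅ ∷ p₆ ∷ p₇ ∷ p₀ ∷ []) =
    p₀ ∷ p₁ ∷ p₂ ∷ p₃ ∷ p₄ ∷ p₅ ∷ p₆ ∷ p₇ ∷ []
  positive : ∀ xs → holds winning xs → All (0 <_) (toList xs)
  positive (x₀ ∷ x₁ ∷ x₂ ∷ x₃ ∷ x₄ ∷ x₅ ∷ x₆ ∷ x₇ ∷ []) ((refl , p₂ , p₃ , p₄ , p₅ , p₆ , refl , s , s′ , lo , _) , _) =
    s≤s z≤n ∷ ≤-trans p₄ lo ∷ p₂ ∷ p₃ ∷ p₄ ∷ p₅ ∷ p₆ ∷ ≤-trans p₄ lo ∷ []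

seven-removeZeros : ∀ zs → Orbit (holds seven) zs → ∃ λ a → 1 ≤ a × removeZeros (toList zs) ≡ replicate 7 a
seven-removeZeros (_ ∷ _ ∷ _ ∷ _ ∷ _ ∷ _ ∷ _ ∷ _ ∷ []) o with Orbit⇒Around o
... | at₀ (refl , s≤s z≤n , refl , refl , refl , refl , refl , refl) = _ , s≤s z≤n , refl
... | at₁ (refl , s≤s z≤n , refl , refl , refl , refl , refl , refl) = _ , s≤s z≤n , refl
... | at₂ (refl , s≤s z≤n , refl , refl , refl , refl , refl , refl) = _ , s≤s z≤n , refl
... | at₃ (refl , s≤s z≤n , refl , refl , refl , refl , refl , refl) = _ , s≤s z≤n , refl
... | at₄ (refl , s≤s z≤n , refl , refl , refl , refl , refl , refl) = _ , s≤s z≤n , refl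
... | at₅ (refl , s≤s z≤n , refl , refl , refl , refl , refl , refl) = _ , s≤s z≤n , refl
... | at₆ (refl , s≤s z≤n , refl , refl , refl , refl , refl , refl) = _ , s≤s z≤n , refl
... | at₇ (refl , s≤s z≤n , refl , refl , refl , refl , refl , refl) = _ , s≤s z≤n , refl

removeZeros-seven : ∀ zs {a} → 1 ≤ a → removeZeros (toList zs) ≡ replicate 7 a → Orbit (holds seven) zs
removeZeros-seven zs@(_ ∷ _ ∷ _ ∷ _ ∷ _ ∷ _ ∷ _ ∷ _ ∷ []) 1≤a eq with removeZeros-single 7 (toList zs) refl eq
... | [] , vs , refl , refl = here h
  where h = refl , 1≤a , refl , refl , refl , refl , refl , refl
... | _ ∷ [] , vs , refl , refl = there (here h)
  where h = refl , 1≤a , refl , refl , refl , refl , refl , refl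
... | _ ∷ _ ∷ [] , vs , refl , refl = there (there (here h))
  where h = refl , 1≤a , refl , refl , refl , refl , refl , refl
... | _ ∷ _ ∷ _ ∷ [] , vs , refl , refl = there (there (there (here h)))
  where h = refl , 1≤a , refl , refl , refl , refl , refl , refl
... | _ ∷ _ ∷ _ ∷ _ ∷ [] , vs , refl , refl = there (there (there (there (here h))))
  where h = refl , 1≤a , refl , refl , refl , refl , refl , refl
... | _ ∷ _ ∷ _ ∷ _ ∷ _ ∷ [] , vs , refl , refl = there (there (there (there (there (here h)))))
  where h = refl , 1≤a , refl , refl , refl , refl , refl , refl
... | _ ∷ _ ∷ _ ∷ _ ∷ _ ∷ _ ∷ [] , vs , refl , refl = there (there (there (there (there (there (here h))))))
  where h = refl , 1≤a , refl , refl , refl , refl , refl , refl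
... | _ ∷ _ ∷ _ ∷ _ ∷ _ ∷ _ ∷ _ ∷ [] , vs , refl , refl = there (there (there (there (there (there (there (here h)))))))
  where h = refl , 1≤a , refl , refl , refl , refl , refl , refl
... | _ ∷ _ ∷ _ ∷ _ ∷ _ ∷ _ ∷ _ ∷ _ ∷ _ , vs , _ , ()

target⇒claimed : ∀ zs → Orbit (holds target) zs → ClaimedP (removeZeros (toList zs))
target⇒claimed zs t with target-split t
... | inj₁ w = subst ClaimedP (sym (removeZeros-id (winning-positive w))) (inj₂ (inj₂ (winning⇒claimed zs w)))
... | inj₂ s = inj₂ (inj₁ (seven-removeZeros zs s))

-- Unclaimed positions have a claimed option

Option : Config → Set
Option c = ∃ λ d → Move 6 c d × ClaimedP d

sucs : ∀ (xs : Octet) → All (0 <_) (toList xs) → ∃ λ ys → xs ≡ Vec.map suc ys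
sucs (_ ∷ _ ∷ _ ∷ _ ∷ _ ∷ _ ∷ _ ∷ _ ∷ []) (s≤s _ ∷ s≤s _ ∷ s≤s _ ∷ s≤s _ ∷ s≤s _ ∷ s≤s _ ∷ s≤s _ ∷ s≤s _ ∷ []) =
  _ ∷ _ ∷ _ ∷ _ ∷ _ ∷ _ ∷ _ ∷ _ ∷ [] , refl

dichotomy₈ : ∀ xs → All (0 <_) (toList xs) → ClaimedP (toList xs) ⊎ Option (toList xs)
dichotomy₈ xs ps with sucs xs ps
... | ys , refl with octet-options ys
...   | zs , b , k , t with pointwise-sum (below⇒pointwise xs zs b) | kept⇒keptAt xs zs k
...     | inj₁ eq | _ = inj₁ (subst ClaimedP (trans (cong removeZeros eq) (removeZeros-id ps)) (target⇒claimed zs t))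
...     | inj₂ lt | u , u<8 , kept₀ , kept₁ = inj₂ (_ , move , target⇒claimed zs t)
  where
  window : ∀ i → i < 8 → at (toList zs) i ≢ at (toList xs) i → InWindow 6 8 ((2 + u) % 8) i
  window i i<8 changed with covers₈ u<8 i<8
  ... | inj₁ refl        = contradiction kept₀ changed
  ... | inj₂ (inj₁ refl) = contradiction kept₁ changed
  ... | inj₂ (inj₂ w)    = w
  move : Move 6 (toList xs) (removeZeros (toList zs))
  move = record
    { zs = toList zs ; smaller = below⇒pointwise xs zs b ; removes = lt ; result = refl
    ; window = inj₂ ((2 + u) % 8 , subst ((2 + u) % 8 <_) (sym len) (m%n<n (2 + u) 8) ,
        λ i i< c → subst (λ r → InWindow 6 r ((2 + u) % 8) i) (sym len) (window i (subst (i <_) len i<) c)) }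
    where len = toList-length xs

-- All piles are lowered to a least one, which is the pile outside the window.
dichotomy₇ : ∀ xs → length xs ≡ 7 → All (0 <_) xs → ClaimedP xs ⊎ Option xs
dichotomy₇ xs@(x ∷ xs′) len ps with argmin x xs′
... | u , u< , ms with pointwise-sum (replicate-below ms)
...   | inj₁ eq = inj₁ (inj₂ (inj₁ (at xs u , at-positive ps u< , trans (sym eq) (cong (λ n → replicate n (at xs u)) len))))
...   | inj₂ lt = inj₂ (replicate 7 (at xs u) , move , inj₂ (inj₁ (at xs u , at-positive ps u< , refl)))
  where
  window : ∀ i → i < 7 → at (replicate (length xs) (at xs u)) i ≢ at xs i → InWindow 6 7 (suc u % 7) i
  window i i<7 changed with covers₇ (subst (u <_) len u<) i<7
  ... | inj₁ refl = contradiction (at-replicate (length xs) u<) changed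
  ... | inj₂ w    = w
  positive : ∀ n {v} → 0 < v → All (0 <_) (replicate n v)
  positive zero    p = []
  positive (suc n) p = p ∷ positive n p
  move : Move 6 xs (replicate 7 (at xs u))
  move = record
    { zs = replicate (length xs) (at xs u) ; smaller = replicate-below ms ; removes = lt
    ; result = trans (cong (λ n → replicate n (at xs u)) (sym len)) (sym (removeZeros-id (positive (length xs) (at-positive ps u<))))
    ; window = inj₂ (suc u % 7 , subst (suc u % 7 <_) (sym len) (m%n<n (suc u) 7) ,
        λ i i< c → subst (λ r → InWindow 6 r (suc u % 7) i) (sym len) (window i (subst (i <_) len i<) c)) }

dichotomy₆ : ∀ xs → length xs ≤ 6 → All (0 <_) xs → ClaimedP xs ⊎ Option xs
dichotomy₆ []           _  _  = inj₁ (inj₁ refl)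
dichotomy₆ xs@(x ∷ xs′) l≤ (p ∷ _) = inj₂ ([] , move , inj₁ refl)
  where
  zeros : ∀ n → sum (replicate n 0) ≡ 0 × removeZeros (replicate n 0) ≡ []
  zeros zero    = refl , refl
  zeros (suc n) = zeros n
  move : Move 6 xs []
  move = record
    { zs = replicate (length xs) 0 ; smaller = replicate-below (All.universal (λ _ → z≤n) xs)
    ; removes = subst (_< sum xs) (sym (proj₁ (zeros (length xs)))) (≤-trans p (m≤m+n x (sum xs′)))
    ; window = inj₁ l≤ ; result = sym (proj₂ (zeros (length xs))) }

dichotomy : ∀ c → All (0 <_) c → length c ≤ 8 → ClaimedP c ⊎ Option c
dichotomy c ps l≤8 with m≤n⇒m<n∨m≡n l≤8
... | inj₂ l≡8 with asOctet c l≡8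
...   | xs , refl = dichotomy₈ xs ps
dichotomy c ps l≤8 | inj₁ (s≤s l≤7) with m≤n⇒m<n∨m≡n l≤7
...   | inj₂ l≡7       = dichotomy₇ c l≡7 ps
...   | inj₁ (s≤s l≤6) = dichotomy₆ c l≤6 ps

-- Claimed positions have no claimed option

claimed₈-length : ∀ {c} → Claimed₈ c → length c ≡ 8
claimed₈-length ((_ , _ , _ , _ , _ , _ , _ , c≈) , _) = sym (≈c-length c≈)

-- The pile outside the window keeps the size a. So the result is not empty, and seven equal piles
-- could only be the original ones, with no stone removed.
sevens-stable : ∀ {a d} → 1 ≤ a → Move 6 (replicate 7 a) d → ¬ ClaimedP d
sevens-stable {a} 1≤a m claimed with Move.window m
... | inj₁ 7≤6 = contradiction 7≤6 (<⇒≱ ≤-refl)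
... | inj₂ (s , s<7 , only) = go claimed
  where
  open Move m
  u = (s + 6) % 7
  u<7 : u < 7
  u<7 = m%n<n (s + 6) 7
  len : length zs ≡ 7
  len = Pointwise-length smaller
  kept-u : at zs u ≡ a
  kept-u with at zs u ≟ at (replicate 7 a) u
  ... | yes eq = trans eq (at-replicate 7 u<7)
  ... | no neq = contradiction (only u u<7 neq) (avoids₇ s<7)
  go : ClaimedP _ → ⊥
  go (inj₁ eq) = contradiction (trans (sym kept-u) (removeZeros-empty zs (trans (sym result) eq) u)) (>⇒≢ 1≤a)
  go (inj₂ (inj₁ (b , _ , eq))) = <⇒≢ removes (cong sum (trans zs≡ (cong (replicate 7) b≡a)))
    where
    zs≡ : zs ≡ replicate 7 b
    zs≡ = trans (sym (removeZeros-full zs (trans (cong length (trans (sym result) eq)) (sym len)))) (trans (sym result) eq)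
    b≡a : b ≡ a
    b≡a = trans (sym (at-replicate 7 u<7)) (trans (cong (λ ys → at ys u) (sym zs≡)) kept-u)
  go (inj₂ (inj₂ c)) = contradiction (removeZeros-length zs)
    (<⇒≱ (≤-reflexive (trans (cong suc len) (trans (sym (claimed₈-length c)) (cong length result)))))

-- Before empty piles are deleted, a claimed result is a target: the empty one is impossible because
-- kept piles are positive, a seven-pile result comes from exactly one zero, and an eight-pile
-- result from none.
octets-stable : ∀ xs {d} → Orbit (holds winning) xs → Move 6 (toList xs) d → ¬ ClaimedP d
octets-stable xs w m claimed with asOctet (Move.zs m) (trans (Pointwise-length (Move.smaller m)) (toList-length xs))
... | zs′ , refl with Move.window m
...   | inj₁ l≤6 = contradiction (subst (_≤ 6) (toList-length xs) l≤6) (<⇒≱ (<ᵇ⇒< 6 8 tt))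
...   | inj₂ (s , s< , only) = <⇒≱ removes
  (subst₂ _≤_ (total-sum xs) (total-sum zs′) (winning-stable w zs′ (pointwise⇒below xs zs′ smaller) kept-pair (goal claimed)))
  where
  open Move m
  total-sum : ∀ xs → total xs ≡ sum (toList xs)
  total-sum (_ ∷ _ ∷ _ ∷ _ ∷ _ ∷ _ ∷ _ ∷ _ ∷ []) = refl
  len = toList-length xs
  s<8 = subst (s <_) len s<
  u = (s + 6) % 8
  unchanged : ∀ i → i < 8 → ¬ InWindow 6 8 s i → at (toList zs′) i ≡ at (toList xs) i
  unchanged i i<8 out with at (toList zs′) i ≟ at (toList xs) i
  ... | yes eq = eq
  ... | no neq = contradiction (subst (λ r → InWindow 6 r s i) len (only i (subst (i <_) (sym len) i<8) neq)) out
  kept-pair : Orbit Kept (zip xs zs′)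
  kept-pair = keptAt⇒kept xs zs′ u (m%n<n (s + 6) 8)
    (unchanged u (m%n<n (s + 6) 8) (proj₁ (avoids₈ s<8)) ,
     unchanged (suc u % 8) (m%n<n (suc u) 8) (proj₂ (avoids₈ s<8)))
  goal : ClaimedP _ → Orbit (holds target) zs′
  goal (inj₁ eq) = contradiction
    (trans (sym (unchanged u (m%n<n (s + 6) 8) (proj₁ (avoids₈ s<8)))) (removeZeros-empty (toList zs′) (trans (sym result) eq) u))
    (>⇒≢ (at-positive (winning-positive w) (subst (u <_) (sym len) (m%n<n (s + 6) 8))))
  goal (inj₂ (inj₁ (b , 1≤b , eq))) =
    Orbit-map {Q = holds target} (λ _ → inj₂) (removeZeros-seven zs′ 1≤b (trans (sym result) eq))
  goal (inj₂ (inj₂ c)) = Orbit-map {Q = holds target} (λ _ → inj₁) (claimed⇒winning zs′ (subst Claimed₈ d≡ c))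
    where
    d≡ : _ ≡ toList zs′
    d≡ = trans result (removeZeros-full (toList zs′)
      (trans (cong length (sym result)) (trans (claimed₈-length c) (sym (toList-length zs′)))))

stable : ∀ {c d} → ClaimedP c → Move 6 c d → ¬ ClaimedP d
stable (inj₁ refl) m _ with Move.zs m | Move.smaller m | Move.removes m
... | [] | [] | ()
stable (inj₂ (inj₁ (a , 1≤a , refl))) m = sevens-stable 1≤a m
stable {c} (inj₂ (inj₂ h)) m with asOctet c (claimed₈-length h)
... | xs , refl = octets-stable xs (claimed⇒winning xs h) m

-- Induction on the number of stones

move-sum : ∀ {c d} → Move 6 c d → sum d < sum c
move-sum m = subst (_< _) (trans (sym (removeZeros-sum zs)) (cong sum (sym result))) removes
  where open Move m

move-positive : ∀ {c d} → Move 6 c d → All (0 <_) d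
move-positive m = subst (All (0 <_)) (sym (Move.result m)) (removeZeros-positive (Move.zs m))

move-length : ∀ {c d} → Move 6 c d → length d ≤ length c
move-length m = subst₂ _≤_ (cong length (sym result)) (Pointwise-length smaller) (removeZeros-length zs)
  where open Move m

-- The induction advances two moves at a time: any move leads to an unclaimed position, and the
-- dichotomy supplies a claimed reply with fewer stones.
claimed⇒P : ∀ c → Acc _<_ (sum c) → length c ≤ 8 → ClaimedP c → IsP 6 c
claimed⇒P c (acc rs) l≤8 h = isP answer
  where
  answer : ∀ d → Move 6 c d → IsN 6 d
  answer d m with dichotomy d (move-positive m) (≤-trans (move-length m) l≤8)
  ... | inj₁ h′           = contradiction h′ (stable h m)
  ... | inj₂ (e , m′ , h′) = isN e m′
    (claimed⇒P e (rs (<-trans (move-sum m′) (move-sum m))) (≤-trans (move-length m′) (≤-trans (move-length m) l≤8)) h′)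

P-N-disjoint : ∀ {k c} → IsP k c → ¬ IsN k c
P-N-disjoint (isP f) (isN d m p) = P-N-disjoint p (f d m)

theorem3p9 : (c : Config) → All (λ x → 0 < x) c → length c ≤ 8 →
    (IsP 6 c → ClaimedP c) × (ClaimedP c → IsP 6 c)
theorem3p9 c ps l≤8 = P⇒claimed , claimed⇒P c (<-wellFounded _) l≤8
  where
  P⇒claimed : IsP 6 c → ClaimedP c
  P⇒claimed p with dichotomy c ps l≤8
  ... | inj₁ h           = h
  ... | inj₂ (d , m , h) = contradiction
    (isN d m (claimed⇒P d (<-wellFounded _) (≤-trans (move-length m) l≤8) h)) (P-N-disjoint p)
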